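{- Let $k$ and $s$ be positive integers with $s\in\{\lceil k/2\rceil,\ldots,k\}$, and for $n\ge 1$ let $b_n^{(k,s)}$ be the number of vertices of $P_{n,k,s}$. Then, as formal power series, $$1+\sum_{n\geq 1} b^{(k,s)}_{n} x^n=\frac{1}{1-kx+(k-s)(k-s-1)x^2}.$$ The sequence satisfies the recurrence $b_{n+2}^{(k,s)}-k\,b_{n+1}^{(k,s)}+(k-s)(k-s-1)\,b_n^{(k,s)}=0$ for $n\ge 2$, with initial values $b_1^{(k,s)}=k$ and $b_2^{(k,s)}=k^2-(k-s)(k-s-1)$. Moreover, for all $n\geq 1$, $$b_n^{(k,s)}=\frac{1}{2^{n+1}}\left(w_-^n+w_+^n+\frac{2k}{w_+-w_- }\left(w_+^n-w_-^n\right)\right),$$ where $w_{+}=k+\sqrt{k^2-4(k-s)(k-s-1)}$ and $w_-=k-\sqrt{k^2-4(k-s)(k-s-1)}$.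
   Context: For positive integers $n,k,s$ let $K=s(n-1)+k$ and let $e_0,\ldots,e_{K-1}$ be the standard basis of $\mathbb{R}^{K}$. For $0\le i\le n-1$ let $\lambda_i=\{si,si+1,\ldots,si+k-1\}$ and $\Delta_{\lambda_i}=\operatorname{conv}\{e_j: j\in\lambda_i\}$. Then $P_{n,k,s}=\sum_{i=0}^{n-1}\Delta_{\lambda_i}$ (Minkowski sum). -}

module Defs where

open import Algebra.Bundles.Raw using (RawSemiring)
import Algebra.Definitions.RawSemiring as RawSemiringDefs
open import Data.Bool.Base using (if_then_else_)
open import Data.Fin.Base using (Fin; toℕ)
open import Data.Fin.Properties using () renaming (_≟_ to _≟ᶠ_)
open import Data.Integer.Base as ℤ using (ℤ; +_)
import Data.Integer.Properties as ℤ
open import Data.Nat.Base as ℕ using (ℕ; zero; suc)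
import Data.Nat.Properties as ℕ
open import Data.Product using (Σ; Σ-syntax; ∃; _×_; _,_; proj₁; proj₂)
open import Data.Rational.Base as ℚ using (ℚ; 0ℚ; 1ℚ; ½; ∣_∣)
import Data.Rational.Properties as ℚ
open import Data.Rational.Solver using (module +-*-Solver)
open import Data.Sum.Base using (_⊎_; inj₁; inj₂)
import Data.Vec.Functional.Relation.Binary.Equality.Setoid as VecEquality
open import Function.Bundles using (Inverse)
open import Level using (0ℓ)
open import Relation.Binary.Bundles using (Setoid)
import Relation.Binary.Construct.On as On
open import Relation.Binary.PropositionalEquality
  using (_≡_; _≢_; refl; sym; trans; cong; cong₂; subst; subst₂)
import Relation.Binary.PropositionalEquality.Properties as ≡
open import Relation.Nullary using (does; yes; no; contradiction)
open import Relation.Unary using (Pred; _∈_)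

open +-*-Solver using (solve; _:+_; _:*_; :-_; _:-_; _:=_; con)

abstract

  half+half : ∀ p → p ℚ.* ½ ℚ.+ p ℚ.* ½ ≡ p
  half+half p = trans (sym (ℚ.*-distribˡ-+ p ½ ½)) (ℚ.*-identityʳ p)

  pos* : ∀ p q → 0ℚ ℚ.< p → 0ℚ ℚ.< q → 0ℚ ℚ.< p ℚ.* q
  pos* p q 0<p 0<q = ℚ.positive⁻¹ (p ℚ.* q)
    {{ℚ.pos*pos⇒pos p {{ℚ.positive 0<p}} q {{ℚ.positive 0<q}}}}

  half>0 : ∀ p → 0ℚ ℚ.< p → 0ℚ ℚ.< p ℚ.* ½
  half>0 p 0<p = pos* p ½ 0<p (ℚ.positive⁻¹ ½)

  *-mono-≤ : ∀ p q r t → 0ℚ ℚ.≤ p → 0ℚ ℚ.≤ t → p ℚ.≤ q → r ℚ.≤ t → p ℚ.* r ℚ.≤ q ℚ.* t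
  *-mono-≤ p q r t 0≤p 0≤t p≤q r≤t = ℚ.≤-trans
    (ℚ.*-monoˡ-≤-nonNeg p {{ℚ.nonNegative 0≤p}} r≤t)
    (ℚ.*-monoʳ-≤-nonNeg t {{ℚ.nonNegative 0≤t}} p≤q)

  ∣p-p∣≡0 : ∀ p → ∣ p ℚ.- p ∣ ≡ 0ℚ
  ∣p-p∣≡0 p = cong ∣_∣ (ℚ.+-inverseʳ p)

  ∣p-q∣≡∣q-p∣ : ∀ p q → ∣ p ℚ.- q ∣ ≡ ∣ q ℚ.- p ∣
  ∣p-q∣≡∣q-p∣ p q = trans (sym (ℚ.∣-p∣≡∣p∣ (p ℚ.- q)))
    (cong ∣_∣ (solve 2 (λ p q → :- (p :- q) := q :- p) refl p q))

  triangle : ∀ p q r → ∣ p ℚ.- r ∣ ℚ.≤ ∣ p ℚ.- q ∣ ℚ.+ ∣ q ℚ.- r ∣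
  triangle p q r = subst (ℚ._≤ ∣ p ℚ.- q ∣ ℚ.+ ∣ q ℚ.- r ∣)
    (cong ∣_∣ (solve 3 (λ p q r → (p :- q) :+ (q :- r) := p :- r) refl p q r))
    (ℚ.∣p+q∣≤∣p∣+∣q∣ (p ℚ.- q) (q ℚ.- r))

  ∣p∣≤∣q∣+∣p-q∣ : ∀ p q → ∣ p ∣ ℚ.≤ ∣ q ∣ ℚ.+ ∣ p ℚ.- q ∣
  ∣p∣≤∣q∣+∣p-q∣ p q = subst (λ z → ∣ z ∣ ℚ.≤ ∣ q ∣ ℚ.+ ∣ p ℚ.- q ∣)
    (solve 2 (λ p q → q :+ (p :- q) := p) refl p q)
    (ℚ.∣p+q∣≤∣p∣+∣q∣ q (p ℚ.- q))

  p≤∣p∣ : ∀ p → p ℚ.≤ ∣ p ∣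
  p≤∣p∣ p with ℚ.≤-total 0ℚ p
  ... | inj₁ 0≤p = ℚ.≤-reflexive (sym (ℚ.0≤p⇒∣p∣≡p 0≤p))
  ... | inj₂ p≤0 = ℚ.≤-trans p≤0 (ℚ.0≤∣p∣ p)

  sum-of-differences : ∀ a b c d → (a ℚ.- b) ℚ.+ (c ℚ.- d) ≡ (a ℚ.+ c) ℚ.- (b ℚ.+ d)
  sum-of-differences = solve 4 (λ a b c d → (a :- b) :+ (c :- d) := (a :+ c) :- (b :+ d)) refl

  difference-of-products : ∀ a b c d →
    a ℚ.* (c ℚ.- d) ℚ.+ d ℚ.* (a ℚ.- b) ≡ a ℚ.* c ℚ.- b ℚ.* d
  difference-of-products =
    solve 4 (λ a b c d → a :* (c :- d) :+ d :* (a :- b) := a :* c :- b :* d) refl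

  x∙yz≡y∙xz : ∀ x y z → x ℚ.* (y ℚ.* z) ≡ y ℚ.* (x ℚ.* z)
  x∙yz≡y∙xz = solve 3 (λ x y z → x :* (y :* z) := y :* (x :* z)) refl

  difference-of-reciprocals : ∀ a b u v →
    (b ℚ.- a) ℚ.* (u ℚ.* v) ≡ b ℚ.* v ℚ.* u ℚ.- a ℚ.* u ℚ.* v
  difference-of-reciprocals =
    solve 4 (λ a b u v → (b :- a) :* (u :* v) := b :* v :* u :- a :* u :* v) refl

  regroup : ∀ e d u v →
    e ℚ.* ((d ℚ.* u) ℚ.* (d ℚ.* v)) ≡ (e ℚ.* (d ℚ.* d)) ℚ.* (u ℚ.* v)
  regroup = solve 4 (λ e d u v → e :* ((d :* u) :* (d :* v)) := (e :* (d :* d)) :* (u :* v)) refl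

  -p+[p+q]≡q : ∀ p q → ℚ.- p ℚ.+ (p ℚ.+ q) ≡ q
  -p+[p+q]≡q = solve 2 (λ p q → :- p :+ (p :+ q) := q) refl

  swap-neg : ∀ p q → q ℚ.- p ≡ (ℚ.- p) ℚ.- (ℚ.- q)
  swap-neg = solve 2 (λ p q → q :- p := (:- p) :- (:- q)) refl

  ∣p∣+1>0 : ∀ p → 0ℚ ℚ.< ∣ p ∣ ℚ.+ 1ℚ
  ∣p∣+1>0 p = ℚ.+-mono-≤-< (ℚ.0≤∣p∣ p) (ℚ.positive⁻¹ 1ℚ)

-- Totalised reciprocal; its value at 0 never matters.
recip : ℚ → ℚ
recip p with p ℚ.≟ 0ℚ
... | yes _   = 0ℚ
... | no  p≢0 = ℚ.1/_ p {{ℚ.≢-nonZero p≢0}}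

abstract

  recip-inverseʳ : ∀ p → p ≢ 0ℚ → p ℚ.* recip p ≡ 1ℚ
  recip-inverseʳ p p≢0 with p ℚ.≟ 0ℚ
  ... | yes p≡0 = contradiction p≡0 p≢0
  ... | no  q   = ℚ.*-inverseʳ p {{ℚ.≢-nonZero q}}

  recip>0 : ∀ p → 0ℚ ℚ.< p → 0ℚ ℚ.< recip p
  recip>0 p 0<p with p ℚ.≟ 0ℚ
  ... | yes p≡0 = contradiction (sym p≡0) (ℚ.<⇒≢ 0<p)
  ... | no  q   = ℚ.positive⁻¹ _ {{ℚ.1/pos⇒pos p {{ℚ.positive 0<p}}}}

-- ℝ consists of the Cauchy sequences of rationals, with a setoid equality
-- _≈_ (two sequences are equal when their difference tends to 0).
-- The relations are records, and the operations are defined by copatterns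
-- without eta, so that their arguments can be inferred by unification.

Eventually : Pred ℕ 0ℓ → Set
Eventually P = ∃ λ N → ∀ n → N ℕ.≤ n → P n

Cauchy : (ℕ → ℚ) → Set
Cauchy x = ∀ ε → 0ℚ ℚ.< ε →
  ∃ λ N → ∀ m n → N ℕ.≤ m → N ℕ.≤ n → ∣ x m ℚ.- x n ∣ ℚ.≤ ε

record ℝ : Set where
  no-eta-equality
  constructor mkℝ
  field
    seq    : ℕ → ℚ
    cauchy : Cauchy seq

open ℝ public

infix 4 _≈_ _≤_ _<_ _#_

record _≈_ (x y : ℝ) : Set where
  constructor mk≈
  field
    close : ∀ ε → 0ℚ ℚ.< ε → Eventually λ n → ∣ seq x n ℚ.- seq y n ∣ ℚ.≤ ε

record _≤_ (x y : ℝ) : Set where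
  constructor mk≤
  field
    below : ∀ ε → 0ℚ ℚ.< ε → Eventually λ n → seq x n ℚ.≤ seq y n ℚ.+ ε

record _<_ (x y : ℝ) : Set where
  constructor mk<
  field
    gap   : ℚ
    gap>0 : 0ℚ ℚ.< gap
    below : Eventually λ n → seq x n ℚ.+ gap ℚ.≤ seq y n

_#_ : ℝ → ℝ → Set
x # y = x < y ⊎ y < x

abstract

  ≈-refl : ∀ {x} → x ≈ x
  ≈-refl {x} = mk≈ λ ε 0<ε → 0 , λ n _ →
    ℚ.≤-trans (ℚ.≤-reflexive (∣p-p∣≡0 (seq x n))) (ℚ.<⇒≤ 0<ε)

  ≈-sym : ∀ {x y} → x ≈ y → y ≈ x
  ≈-sym {x} {y} (mk≈ x≈y) = mk≈ λ ε 0<ε →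
    let N , h = x≈y ε 0<ε in N , λ n N≤n →
      subst (ℚ._≤ ε) (∣p-q∣≡∣q-p∣ (seq x n) (seq y n)) (h n N≤n)

  ≈-trans : ∀ {x y z} → x ≈ y → y ≈ z → x ≈ z
  ≈-trans {x} {y} {z} (mk≈ x≈y) (mk≈ y≈z) = mk≈ λ ε 0<ε →
    let M , f = x≈y (ε ℚ.* ½) (half>0 ε 0<ε)
        N , g = y≈z (ε ℚ.* ½) (half>0 ε 0<ε)
    in M ℕ.⊔ N , λ n le →
      ℚ.≤-trans (triangle (seq x n) (seq y n) (seq z n))
        (subst (∣ seq x n ℚ.- seq y n ∣ ℚ.+ ∣ seq y n ℚ.- seq z n ∣ ℚ.≤_) (half+half ε)
          (ℚ.+-mono-≤ (f n (ℕ.m⊔n≤o⇒m≤o M N le)) (g n (ℕ.m⊔n≤o⇒n≤o M N le))))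

ℝ-setoid : Setoid 0ℓ 0ℓ
ℝ-setoid = record
  { Carrier       = ℝ
  ; _≈_           = _≈_
  ; isEquivalence = record
    { refl  = ≈-refl
    ; sym   = ≈-sym
    ; trans = ≈-trans
    }
  }

abstract

  const-cauchy : ∀ p → Cauchy (λ _ → p)
  const-cauchy p ε 0<ε = 0 , λ _ _ _ _ →
    ℚ.≤-trans (ℚ.≤-reflexive (∣p-p∣≡0 p)) (ℚ.<⇒≤ 0<ε)

  +-cauchy : ∀ x y → Cauchy x → Cauchy y → Cauchy (λ n → x n ℚ.+ y n)
  +-cauchy x y cx cy ε 0<ε
    with cx (ε ℚ.* ½) (half>0 ε 0<ε) | cy (ε ℚ.* ½) (half>0 ε 0<ε)
  ... | M , f | N , g = M ℕ.⊔ N , λ m n lm ln →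
    subst₂ ℚ._≤_
      (cong ∣_∣ (sum-of-differences (x m) (x n) (y m) (y n)))
      (half+half ε)
      (ℚ.≤-trans (ℚ.∣p+q∣≤∣p∣+∣q∣ (x m ℚ.- x n) (y m ℚ.- y n))
        (ℚ.+-mono-≤
          (f m n (ℕ.≤-trans (ℕ.m≤m⊔n M N) lm) (ℕ.≤-trans (ℕ.m≤m⊔n M N) ln))
          (g m n (ℕ.≤-trans (ℕ.m≤n⊔m M N) lm) (ℕ.≤-trans (ℕ.m≤n⊔m M N) ln))))

  neg-cauchy : ∀ x → Cauchy x → Cauchy (λ n → ℚ.- x n)
  neg-cauchy x cx ε 0<ε with cx ε 0<ε
  ... | N , f = N , λ m n lm ln → subst (ℚ._≤ ε)
    (cong ∣_∣ (swap-neg (x m) (x n)))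
    (f n m ln lm)

  cauchy-bound : ∀ x → Cauchy x →
    ∃ λ B → 0ℚ ℚ.< B × Eventually λ n → ∣ x n ∣ ℚ.≤ B
  cauchy-bound x cx with cx 1ℚ (ℚ.positive⁻¹ 1ℚ)
  ... | N , f = ∣ x N ∣ ℚ.+ 1ℚ , ∣p∣+1>0 (x N) , N , λ n le →
    ℚ.≤-trans (∣p∣≤∣q∣+∣p-q∣ (x n) (x N))
      (ℚ.+-monoʳ-≤ ∣ x N ∣ (f n N le ℕ.≤-refl))

  scaled : ℚ → ℚ → ℚ
  scaled ε C = ε ℚ.* ½ ℚ.* recip C

  scaled>0 : ∀ ε C → 0ℚ ℚ.< ε → 0ℚ ℚ.< C → 0ℚ ℚ.< scaled ε C
  scaled>0 ε C 0<ε 0<C = pos* (ε ℚ.* ½) (recip C) (half>0 ε 0<ε) (recip>0 C 0<C)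

  C*scaled : ∀ ε C → 0ℚ ℚ.< C → C ℚ.* scaled ε C ≡ ε ℚ.* ½
  C*scaled ε C 0<C = begin
    C ℚ.* (ε ℚ.* ½ ℚ.* recip C)  ≡⟨ x∙yz≡y∙xz C (ε ℚ.* ½) (recip C) ⟩
    ε ℚ.* ½ ℚ.* (C ℚ.* recip C)  ≡⟨ cong (ε ℚ.* ½ ℚ.*_) (recip-inverseʳ C C≢0) ⟩
    ε ℚ.* ½ ℚ.* 1ℚ               ≡⟨ ℚ.*-identityʳ (ε ℚ.* ½) ⟩
    ε ℚ.* ½                      ∎
    where
    open ≡.≡-Reasoning
    C≢0 : C ≢ 0ℚ
    C≢0 C≡0 = ℚ.<⇒≢ {0ℚ} {C} 0<C (sym C≡0)

  product-bound : ∀ ε C u v → 0ℚ ℚ.< ε → 0ℚ ℚ.< C → ∣ u ∣ ℚ.≤ C → ∣ v ∣ ℚ.≤ scaled ε C →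
                  ∣ u ℚ.* v ∣ ℚ.≤ ε ℚ.* ½
  product-bound ε C u v 0<ε 0<C u≤C v≤ = begin
    ∣ u ℚ.* v ∣       ≡⟨ ℚ.∣p*q∣≡∣p∣*∣q∣ u v ⟩
    ∣ u ∣ ℚ.* ∣ v ∣   ≤⟨ *-mono-≤ (∣ u ∣) C (∣ v ∣) (scaled ε C) (ℚ.0≤∣p∣ u)
                           (ℚ.<⇒≤ (scaled>0 ε C 0<ε 0<C)) u≤C v≤ ⟩
    C ℚ.* scaled ε C  ≡⟨ C*scaled ε C 0<C ⟩
    ε ℚ.* ½           ∎
    where open ℚ.≤-Reasoning

  products-close : ∀ ε A B a b c d → 0ℚ ℚ.< ε → 0ℚ ℚ.< A → 0ℚ ℚ.< B →
    ∣ a ∣ ℚ.≤ A → ∣ d ∣ ℚ.≤ B → ∣ c ℚ.- d ∣ ℚ.≤ scaled ε A → ∣ a ℚ.- b ∣ ℚ.≤ scaled ε B →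
    ∣ a ℚ.* c ℚ.- b ℚ.* d ∣ ℚ.≤ ε
  products-close ε A B a b c d 0<ε 0<A 0<B a≤ d≤ cd≤ ab≤ = begin
    ∣ a ℚ.* c ℚ.- b ℚ.* d ∣
      ≡⟨ cong ∣_∣ (difference-of-products a b c d) ⟨
    ∣ a ℚ.* (c ℚ.- d) ℚ.+ d ℚ.* (a ℚ.- b) ∣
      ≤⟨ ℚ.∣p+q∣≤∣p∣+∣q∣ (a ℚ.* (c ℚ.- d)) (d ℚ.* (a ℚ.- b)) ⟩
    ∣ a ℚ.* (c ℚ.- d) ∣ ℚ.+ ∣ d ℚ.* (a ℚ.- b) ∣
      ≤⟨ ℚ.+-mono-≤ (product-bound ε A a (c ℚ.- d) 0<ε 0<A a≤ cd≤)
                    (product-bound ε B d (a ℚ.- b) 0<ε 0<B d≤ ab≤) ⟩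
    ε ℚ.* ½ ℚ.+ ε ℚ.* ½
      ≡⟨ half+half ε ⟩
    ε ∎
    where open ℚ.≤-Reasoning

  *-cauchy : ∀ x y → Cauchy x → Cauchy y → Cauchy (λ n → x n ℚ.* y n)
  *-cauchy x y cx cy ε 0<ε =
    let A , 0<A , N₁ , f₁ = cauchy-bound x cx
        B , 0<B , N₂ , f₂ = cauchy-bound y cy
        N₃ , f₃ = cx (scaled ε B) (scaled>0 ε B 0<ε 0<B)
        N₄ , f₄ = cy (scaled ε A) (scaled>0 ε A 0<ε 0<A)
        M₁ = N₁ ℕ.⊔ N₂
        M₂ = N₃ ℕ.⊔ N₄
    in M₁ ℕ.⊔ M₂ , λ m n lm ln →
      products-close ε A B (x m) (x n) (y m) (y n) 0<ε 0<A 0<B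
        (f₁ m (ℕ.m⊔n≤o⇒m≤o N₁ N₂ (ℕ.m⊔n≤o⇒m≤o M₁ M₂ lm)))
        (f₂ n (ℕ.m⊔n≤o⇒n≤o N₁ N₂ (ℕ.m⊔n≤o⇒m≤o M₁ M₂ ln)))
        (f₄ m n (ℕ.m⊔n≤o⇒n≤o N₃ N₄ (ℕ.m⊔n≤o⇒n≤o M₁ M₂ lm))
                (ℕ.m⊔n≤o⇒n≤o N₃ N₄ (ℕ.m⊔n≤o⇒n≤o M₁ M₂ ln)))
        (f₃ m n (ℕ.m⊔n≤o⇒m≤o N₃ N₄ (ℕ.m⊔n≤o⇒n≤o M₁ M₂ lm))
                (ℕ.m⊔n≤o⇒m≤o N₃ N₄ (ℕ.m⊔n≤o⇒n≤o M₁ M₂ ln)))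

  recip-cauchy : ∀ x δ → Cauchy x → 0ℚ ℚ.< δ → Eventually (λ n → δ ℚ.≤ ∣ x n ∣) →
                 Cauchy (λ n → recip (x n))
  recip-cauchy x δ cx 0<δ (N₁ , f₁) ε 0<ε
    with cx (ε ℚ.* (δ ℚ.* δ)) (pos* ε (δ ℚ.* δ) 0<ε (pos* δ δ 0<δ 0<δ))
  ... | N₂ , f₂ = N₁ ℕ.⊔ N₂ , λ m n lm ln →
    bound (x m) (x n) (f₁ m (ℕ.≤-trans (ℕ.m≤m⊔n N₁ N₂) lm)) (f₁ n (ℕ.≤-trans (ℕ.m≤m⊔n N₁ N₂) ln))
          (f₂ n m (ℕ.≤-trans (ℕ.m≤n⊔m N₁ N₂) ln) (ℕ.≤-trans (ℕ.m≤n⊔m N₁ N₂) lm))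
    where
    ≢0 : ∀ a → δ ℚ.≤ ∣ a ∣ → a ≢ 0ℚ
    ≢0 _ δ≤ refl = ℚ.<⇒≢ (ℚ.<-≤-trans 0<δ δ≤) refl

    δ*recip≤1 : ∀ a → δ ℚ.≤ ∣ a ∣ → δ ℚ.* ∣ recip a ∣ ℚ.≤ 1ℚ
    δ*recip≤1 a δ≤ = subst (δ ℚ.* ∣ recip a ∣ ℚ.≤_)
      (trans (sym (ℚ.∣p*q∣≡∣p∣*∣q∣ a (recip a))) (cong ∣_∣ (recip-inverseʳ a (≢0 a δ≤))))
      (ℚ.*-monoʳ-≤-nonNeg ∣ recip a ∣ {{ℚ.nonNegative (ℚ.0≤∣p∣ (recip a))}} δ≤)

    0≤δ* : ∀ a → 0ℚ ℚ.≤ δ ℚ.* ∣ a ∣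
    0≤δ* a = subst (ℚ._≤ δ ℚ.* ∣ a ∣) (ℚ.*-zeroʳ δ)
      (ℚ.*-monoˡ-≤-nonNeg δ {{ℚ.nonNegative (ℚ.<⇒≤ 0<δ)}} (ℚ.0≤∣p∣ a))

    diff : ∀ a b → a ≢ 0ℚ → b ≢ 0ℚ →
           (b ℚ.- a) ℚ.* (recip a ℚ.* recip b) ≡ recip a ℚ.- recip b
    diff a b a≢0 b≢0 = trans
      (difference-of-reciprocals a b (recip a) (recip b))
      (cong₂ ℚ._-_
        (trans (cong (ℚ._* recip a) (recip-inverseʳ b b≢0)) (ℚ.*-identityˡ (recip a)))
        (trans (cong (ℚ._* recip b) (recip-inverseʳ a a≢0)) (ℚ.*-identityˡ (recip b))))

    bound : ∀ a b → δ ℚ.≤ ∣ a ∣ → δ ℚ.≤ ∣ b ∣ → ∣ b ℚ.- a ∣ ℚ.≤ ε ℚ.* (δ ℚ.* δ) →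
            ∣ recip a ℚ.- recip b ∣ ℚ.≤ ε
    bound a b δ≤a δ≤b ab≤ =
      let u = ∣ recip a ∣ ; v = ∣ recip b ∣
          eq : ∣ recip a ℚ.- recip b ∣ ≡ ∣ b ℚ.- a ∣ ℚ.* (u ℚ.* v)
          eq = trans (cong ∣_∣ (sym (diff a b (≢0 a δ≤a) (≢0 b δ≤b))))
            (trans (ℚ.∣p*q∣≡∣p∣*∣q∣ (b ℚ.- a) (recip a ℚ.* recip b))
              (cong (∣ b ℚ.- a ∣ ℚ.*_) (ℚ.∣p*q∣≡∣p∣*∣q∣ (recip a) (recip b))))
          0≤uv : 0ℚ ℚ.≤ u ℚ.* v
          0≤uv = subst (0ℚ ℚ.≤_) (ℚ.∣p*q∣≡∣p∣*∣q∣ (recip a) (recip b))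
                   (ℚ.0≤∣p∣ (recip a ℚ.* recip b))
      in
      ℚ.≤-trans (ℚ.≤-reflexive eq)
      (ℚ.≤-trans (ℚ.*-monoʳ-≤-nonNeg (u ℚ.* v) {{ℚ.nonNegative 0≤uv}} ab≤)
      (subst₂ ℚ._≤_
        (regroup ε δ u v)
        (ℚ.*-identityʳ ε)
        (ℚ.*-monoˡ-≤-nonNeg ε {{ℚ.nonNegative (ℚ.<⇒≤ 0<ε)}}
          (*-mono-≤ (δ ℚ.* u) 1ℚ (δ ℚ.* v) 1ℚ (0≤δ* (recip a)) (ℚ.0≤∣p∣ 1ℚ)
            (δ*recip≤1 a δ≤a) (δ*recip≤1 b δ≤b)))))

infixl 6 _+_ _-_
infixl 7 _*_
infix  8 -_

fromℚ : ℚ → ℝ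
fromℚ p .seq _  = p
fromℚ p .cauchy = const-cauchy p

fromℤ : ℤ → ℝ
fromℤ z = fromℚ (z ℚ./ 1)

0ℝ 1ℝ : ℝ
0ℝ = fromℚ 0ℚ
1ℝ = fromℚ 1ℚ

_+_ : ℝ → ℝ → ℝ
(x + y) .seq n  = seq x n ℚ.+ seq y n
(x + y) .cauchy = +-cauchy (seq x) (seq y) (cauchy x) (cauchy y)

_*_ : ℝ → ℝ → ℝ
(x * y) .seq n  = seq x n ℚ.* seq y n
(x * y) .cauchy = *-cauchy (seq x) (seq y) (cauchy x) (cauchy y)

-_ : ℝ → ℝ
(- x) .seq n  = ℚ.- seq x n
(- x) .cauchy = neg-cauchy (seq x) (cauchy x)

_-_ : ℝ → ℝ → ℝ
x - y = x + (- y)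

abstract

  #0⇒bounded-away : ∀ x → x # 0ℝ →
    ∃ λ δ → 0ℚ ℚ.< δ × Eventually λ n → δ ℚ.≤ ∣ seq x n ∣
  #0⇒bounded-away x (inj₁ (mk< δ 0<δ (N , f))) = δ , 0<δ , N , λ n le →
    ℚ.≤-trans
      (subst₂ ℚ._≤_
        (-p+[p+q]≡q (seq x n) δ)
        (ℚ.+-identityʳ (ℚ.- seq x n))
        (ℚ.+-monoʳ-≤ (ℚ.- seq x n) (f n le)))
      (ℚ.≤-trans (p≤∣p∣ (ℚ.- seq x n)) (ℚ.≤-reflexive (ℚ.∣-p∣≡∣p∣ (seq x n))))
  #0⇒bounded-away x (inj₂ (mk< δ 0<δ (N , f))) = δ , 0<δ , N , λ n le →
    ℚ.≤-trans (subst (ℚ._≤ seq x n) (ℚ.+-identityˡ δ) (f n le)) (p≤∣p∣ (seq x n))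

inv : (x : ℝ) → x # 0ℝ → ℝ
inv x x#0 .seq n  = recip (seq x n)
inv x x#0 .cauchy = let δ , 0<δ , h = #0⇒bounded-away x x#0 in
  recip-cauchy (seq x) δ (cauchy x) 0<δ h

infixl 7 _÷_[_]

_÷_[_] : (x y : ℝ) → y # 0ℝ → ℝ
x ÷ y [ y#0 ] = x * inv y y#0

ℝ-rawSemiring : RawSemiring 0ℓ 0ℓ
ℝ-rawSemiring = record
  { Carrier = ℝ ; _≈_ = _≈_ ; _+_ = _+_ ; _*_ = _*_ ; 0# = 0ℝ ; 1# = 1ℝ }

open RawSemiringDefs ℝ-rawSemiring public using (sum; _^_)

infix 4 _IsSqrtOf_

_IsSqrtOf_ : ℝ → ℝ → Set
r IsSqrtOf x = 0ℝ ≤ r × r * r ≈ x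

open VecEquality ℝ-setoid public using (_≋_; ≋-setoid)

Point : ℕ → Set
Point d = Fin d → ℝ

basis : ∀ {d} → Fin d → Point d
basis j l = if does (j ≟ᶠ l) then 1ℝ else 0ℝ

infix 7 _∙_

_∙_ : ∀ {d} → Point d → Point d → ℝ
x ∙ y = sum λ j → x j * y j

conv : ∀ {d} → Pred (Point d) 0ℓ → Pred (Point d) 0ℓ
conv {d} S x =
  Σ[ m ∈ ℕ ] Σ[ p ∈ (Fin m → Point d) ] Σ[ c ∈ (Fin m → ℝ) ]
    (∀ i → p i ∈ S) × (∀ i → 0ℝ ≤ c i) × sum c ≈ 1ℝ ×
    x ≋ (λ j → sum λ i → c i * p i j)

minkowskiSum : ∀ {d n} → (Fin n → Pred (Point d) 0ℓ) → Pred (Point d) 0ℓ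
minkowskiSum {d} {n} A x =
  Σ[ y ∈ (Fin n → Point d) ]
    (∀ i → y i ∈ A i) × x ≋ (λ j → sum λ i → y i j)

-- v is a zero-dimensional face: {v} is the set of maximisers over P of some
-- linear functional.
IsVertex : ∀ {d} → Pred (Point d) 0ℓ → Pred (Point d) 0ℓ
IsVertex {d} P v =
  v ∈ P × Σ[ c ∈ Point d ]
    (∀ x → x ∈ P → c ∙ x ≤ c ∙ v × (c ∙ x ≈ c ∙ v → x ≋ v))

vertices : ∀ {d} → Pred (Point d) 0ℓ → Setoid 0ℓ 0ℓ
vertices {d} P = On.setoid {B = ∃ (IsVertex P)} (≋-setoid d) proj₁

-- Vertices are identified when they are equal as points; the functionals
-- exposing them are ignored.
HasVertexCount : ∀ {d} → Pred (Point d) 0ℓ → ℕ → Set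
HasVertexCount P N = Inverse (≡.setoid (Fin N)) (vertices P)

-- The ambient dimension s(n-1)+k is only meaningful for n ≥ 1.
ambientDim : (n k s : ℕ) → ℕ
ambientDim n k s = s ℕ.* (n ℕ.∸ 1) ℕ.+ k

interval : ∀ {d} (k s i : ℕ) → Pred (Fin d) 0ℓ
interval k s i j = s ℕ.* i ℕ.≤ toℕ j × toℕ j ℕ.< s ℕ.* i ℕ.+ k

simplex : ∀ {d} → Pred (Fin d) 0ℓ → Pred (Point d) 0ℓ
simplex I = conv λ x → ∃ λ j → j ∈ I × x ≋ basis j

polytope : (n k s : ℕ) → Pred (Point (ambientDim n k s)) 0ℓ
polytope n k s = minkowskiSum {n = n} λ i → simplex (interval k s (toℕ i))

PowerSeries : Set
PowerSeries = ℕ → ℤ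

infixl 7 _⊛_

_⊛_ : PowerSeries → PowerSeries → PowerSeries
(f ⊛ g) n = RawSemiringDefs.sum ℤ.+-*-rawSemiring
  {suc n} λ i → f (toℕ i) ℤ.* g (n ℕ.∸ toℕ i)

1ₛ : PowerSeries
1ₛ zero    = ℤ.1ℤ
1ₛ (suc _) = ℤ.0ℤ

-- f = 1/g in the ring of formal power series
infix 4 _IsInverseOf_

_IsInverseOf_ : PowerSeries → PowerSeries → Set
f IsInverseOf g = ∀ n → (f ⊛ g) n ≡ 1ₛ n

-- 1 + Σ_{n≥1} bₙ xⁿ; the value b 0 is ignored.
1+Σ_ : (ℕ → ℕ) → PowerSeries
(1+Σ b) zero    = ℤ.1ℤ
(1+Σ b) (suc n) = + b (suc n)

-- (k - s)(k - s - 1); for k = s the second factor is -1, hence ℤ.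
coeff₂ : (k s : ℕ) → ℤ
coeff₂ k s = (+ k ℤ.- + s) ℤ.* (+ k ℤ.- + s ℤ.- + 1)

denominator : (k s : ℕ) → PowerSeries
denominator k s 0 = + 1
denominator k s 1 = ℤ.- + k
denominator k s 2 = coeff₂ k s
denominator k s (suc (suc (suc _))) = + 0

-- The parameter √D below stands for the square root of discriminant k s; by
-- _IsSqrtOf_ it is the nonnegative one, hence unique up to _≈_.

discriminant : (k s : ℕ) → ℝ
discriminant k s = fromℤ ((+ k) ℤ.^ 2 ℤ.- + 4 ℤ.* coeff₂ k s)

w₊ w₋ : (k : ℕ) (√D : ℝ) → ℝ
w₊ k √D = fromℤ (+ k) + √D
w₋ k √D = fromℤ (+ k) - √D

closedForm : (k : ℕ) (√D : ℝ) → w₊ k √D - w₋ k √D # 0ℝ → ℕ → ℝ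
closedForm k √D w₊-w₋#0 n =
  fromℚ ½ ^ (n ℕ.+ 1) *
    (w₋ k √D ^ n + w₊ k √D ^ n +
      fromℤ (+ 2 ℤ.* + k) ÷ (w₊ k √D - w₋ k √D) [ w₊-w₋#0 ] * (w₊ k √D ^ n - w₋ k √D ^ n))

{-# OPTIONS --safe #-}

-- Since k ≤ 2 s, only consecutive intervals λ_i overlap, in m = k - s elements. A functional exposes a
-- point of a Minkowski sum iff it exposes every summand of that point, and the summands are then unique;
-- so the vertices of P correspond to the choices j_i ∈ λ_i such that some c attains its strict maximum
-- over each λ_i at j_i. If j_i ≠ j_{i+1} both lie in λ_i ∩ λ_{i+1}, then c would have to be larger at each
-- of them than at the other; if this never happens, such a c is built one interval at a time. Prepending
-- an interval to an admissible choice offers k elements, and the forbidden continuations are the m (m - 1)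
-- pairs of distinct elements of the overlap, each completed by an arbitrary admissible choice for the
-- remaining intervals: b_{n+2} = k b_{n+1} - m (m - 1) b_n. Everything else follows from this recurrence.
-- The summands of a vertex are found constructively, because one of finitely many real weights with sum 1
-- is provably positive.

module Submission where

open import Defs
open import Algebra.Bundles using (CommutativeRing)
open import Data.Bool.Base using (true; false; if_then_else_)
open import Data.Empty using (⊥; ⊥-elim)
open import Data.Fin.Base using (Fin; zero; suc; toℕ; fromℕ<; inject₁)
open import Data.Fin.Properties
  using (toℕ-injective; toℕ-fromℕ<; toℕ≤pred[n]; toℕ-inject₁) renaming (_≟_ to _≟ᶠ_)
open import Data.Integer.Base as ℤ using (ℤ; +_)
import Data.Integer.Properties as ℤ
import Data.Integer.Solver as ℤ-Solver
open import Data.List.Base as List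
  using (List; []; _∷_; _++_; map; upTo; applyUpTo; cartesianProductWith; length)
open import Data.List.Membership.Propositional using () renaming (_∈_ to _∈ₗ_)
open import Data.List.Membership.Propositional.Properties
  using (∈-++⁺ˡ; ∈-++⁺ʳ; ∈-++⁻; ∈-map⁺; ∈-map⁻; ∈-cartesianProductWith⁺; ∈-cartesianProductWith⁻;
         ∈-upTo⁺; ∈-upTo⁻; ∈-applyUpTo⁺; ∈-applyUpTo⁻; ∈-lookup)
open import Data.List.Properties using (length-++; length-map; length-upTo; length-applyUpTo)
import Data.List.Relation.Unary.All as All
open import Data.List.Relation.Unary.AllPairs using ([]; _∷_)
open import Data.List.Relation.Unary.Any as Any using (here)
open import Data.List.Relation.Unary.Any.Properties using (lookup-index)
open import Data.List.Relation.Unary.Unique.Propositional using (Unique)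
import Data.List.Relation.Unary.Unique.Propositional.Properties as Unique
open import Data.Nat.Base as ℕ using (ℕ; zero; suc; ⌈_/2⌉; ⌊_/2⌋)
import Data.Nat.Properties as ℕ
import Data.Nat.Solver as ℕ-Solver
open import Data.Product using (Σ-syntax; ∃; _×_; _,_; proj₁; proj₂)
open import Data.Rational.Base as ℚ using (ℚ; 0ℚ; 1ℚ; ½; ∣_∣)
import Data.Rational.Properties as ℚ
import Data.Rational.Solver as ℚ-Solver
import Data.Rational.Unnormalised.Base as ℚᵘ
import Data.Rational.Unnormalised.Properties as ℚᵘ
open import Data.Sum.Base using (_⊎_; inj₁; inj₂)
open import Data.Unit.Base using (⊤; tt)
open import Data.Vec.Base using (Vec; []; _∷_; lookup; tabulate)
open import Data.Vec.Functional using (updateAt)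
open import Data.Vec.Functional.Properties using (updateAt-updates; updateAt-minimal)
open import Data.Vec.Properties
  using (∷-injective; ∷-injectiveʳ; lookup∘tabulate; tabulate∘lookup; tabulate-cong)
open import Function.Base using (const; _∘_)
open import Level using (0ℓ)
import Relation.Binary.Reasoning.Setoid
open import Relation.Binary.PropositionalEquality
  using (_≡_; _≢_; refl; sym; trans; cong; cong₂; subst; subst₂; module ≡-Reasoning)
open import Relation.Nullary using (¬_; does; yes; no; contradiction)
open import Relation.Nullary.Decidable using (dec-true; dec-false)
open import Relation.Unary using (Pred; _∈_)

-- The count is organised so that nothing is subtracted. An offset below m lies in the overlap with
-- the preceding interval and, because m ≤ s, never in the overlap with the following one. So a head
-- below m can conflict only with its predecessor, and a head from m on only with its successor.
-- Splitting the sequences by this test gives two lists whose lengths satisfy a linear system with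
-- nonnegative coefficients; the term m (m - 1) appears only when one of the two lengths is
-- eliminated. The empty sequence gives the value 1 at n = 0, and with it the recurrence holds from
-- n = 0 on, which is the form that the power series and the closed form use. On the geometric side,
-- equality and order of reals cannot be decided. The index of a vertex is therefore computed from
-- the functional and the summands that come with it, and it has to be shown that the result depends
-- on the point alone.

lookup-injective : ∀ {A : Set} {xs : List A} → Unique xs → ∀ i j →
                   List.lookup xs i ≡ List.lookup xs j → i ≡ j
lookup-injective (px ∷ _)  zero    zero    _  = refl
lookup-injective (px ∷ _)  zero    (suc j) eq = contradiction eq (All.lookup px (∈-lookup j))
lookup-injective (px ∷ _)  (suc i) zero    eq = contradiction (sym eq) (All.lookup px (∈-lookup i))
lookup-injective (_ ∷ pxs) (suc i) (suc j) eq = cong suc (lookup-injective pxs i j eq)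

lookup-extensional : ∀ {A : Set} {n} {xs ys : Vec A n} → (∀ i → lookup xs i ≡ lookup ys i) → xs ≡ ys
lookup-extensional {xs = xs} {ys} eq =
  trans (sym (tabulate∘lookup xs)) (trans (tabulate-cong eq) (tabulate∘lookup ys))

length-cartesianProductWith : ∀ {A B C : Set} (f : A → B → C) xs ys →
  length (cartesianProductWith f xs ys) ≡ length xs ℕ.* length ys
length-cartesianProductWith f []       ys = refl
length-cartesianProductWith f (x ∷ xs) ys = trans (length-++ (map (f x) ys))
  (cong₂ ℕ._+_ (length-map (f x) ys) (length-cartesianProductWith f xs ys))

-- A choice of one element from each λ_i is encoded by its offsets: o at index i stands for the
-- element s i + o.  With m = k - s, consecutive intervals overlap in the offsets o ≥ s of the first,
-- which are the offsets o < m of the second, and 2 s ≥ k means m ≤ s.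
module Offsets (s m : ℕ) (m≤s : m ℕ.≤ s) where

  k : ℕ
  k = s ℕ.+ m

  -- The three ways to avoid a conflict: `o` lies before the overlap, `o′` lies after it, or both
  -- offsets name the same element, which the next interval numbers `s` lower. A disjunction suits
  -- the enumeration, which splits on it.
  Compatible : ∀ {n} → ℕ → Vec ℕ n → Set
  Compatible o []       = ⊤
  Compatible o (o′ ∷ _) = o ℕ.< s ⊎ m ℕ.≤ o′ ⊎ o ≡ s ℕ.+ o′

  data Admissible : ∀ {n} → Vec ℕ n → Set where
    []   : Admissible []
    cons : ∀ {n o} {os : Vec ℕ n} → o ℕ.< k → Compatible o os → Admissible os → Admissible (o ∷ os)

  bounded : ∀ {n} {os : Vec ℕ n} → Admissible os → ∀ i → lookup os i ℕ.< k
  bounded (cons o<k _ _) zero    = o<k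
  bounded (cons _ _ adm) (suc i) = bounded adm i

  -- An exposing functional yields an implication for each pair of neighbours; deciding two
  -- comparisons of offsets turns it into the disjunction of `Compatible`.
  admissible : ∀ {n} (os : Vec ℕ (suc n)) → (∀ i → lookup os i ℕ.< k) →
    (∀ (i : Fin n) → s ℕ.≤ lookup os (inject₁ i) → lookup os (suc i) ℕ.< m →
      lookup os (inject₁ i) ≡ s ℕ.+ lookup os (suc i)) →
    Admissible os
  admissible (o ∷ [])      lt compat = cons (lt zero) tt []
  admissible (o ∷ o′ ∷ os) lt compat =
    cons (lt zero) compatible (admissible (o′ ∷ os) (λ i → lt (suc i)) (λ i → compat (suc i)))
    where
    compatible : Compatible o (o′ ∷ os)
    compatible with o ℕ.<? s | o′ ℕ.<? m
    ... | yes o<s | _        = inj₁ o<s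
    ... | no  _   | no  o′≮m = inj₂ (inj₁ (ℕ.≮⇒≥ o′≮m))
    ... | no  o≮s | yes o′<m = inj₂ (inj₂ (compat zero (ℕ.≮⇒≥ o≮s) o′<m))

  -- A functional selecting a given admissible choice. Doubling the heights of the tail leaves room
  -- for a height 1 strictly between the unchosen elements and the head of the tail.

  weight : ∀ {n} → Vec ℕ n → ℕ
  weight []       = 0
  weight (o ∷ os) = if does (o ℕ.<? s) then suc (2 ℕ.* weight os) else 1

  -- Here `p` counts from the start of the first interval, so the tail sees it as `p ∸ s`. Both
  -- contributions can meet at one position: a head `o ≥ s` is also an element of the next interval.
  height : ∀ {n} → Vec ℕ n → ℕ → ℕ
  height []           p = 0
  height os@(o ∷ os′) p =
    (if does (p ℕ.≟ o) then weight os else 0) ℕ.+ (if does (s ℕ.≤? p) then 2 ℕ.* height os′ (p ℕ.∸ s) else 0)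

  1≤weight : ∀ {n} o (os : Vec ℕ n) → 1 ℕ.≤ weight (o ∷ os)
  1≤weight o os with does (o ℕ.<? s)
  ... | true  = ℕ.s≤s ℕ.z≤n
  ... | false = ℕ.s≤s ℕ.z≤n

  height-chosen : ∀ {n} o (os : Vec ℕ n) → weight (o ∷ os) ℕ.≤ height (o ∷ os) o
  height-chosen o os rewrite dec-true (o ℕ.≟ o) refl = ℕ.m≤m+n (weight (o ∷ os)) _

  height-unchosen : ∀ {n} o (os : Vec ℕ n) p → p ≢ o → p ℕ.< s → height (o ∷ os) p ≡ 0
  height-unchosen o os p p≢o p<s
    rewrite dec-false (p ℕ.≟ o) p≢o | dec-false (s ℕ.≤? p) (ℕ.<⇒≱ p<s) = refl

  height-shift : ∀ {n} o (os : Vec ℕ n) q →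
    height (o ∷ os) (s ℕ.+ q) ≡ (if does (s ℕ.+ q ℕ.≟ o) then weight (o ∷ os) else 0) ℕ.+ 2 ℕ.* height os q
  height-shift o os q rewrite dec-true (s ℕ.≤? s ℕ.+ q) (ℕ.m≤m+n s q) | ℕ.m+n∸m≡n s q = refl

  height-shift-unchosen : ∀ {n} o (os : Vec ℕ n) q → s ℕ.+ q ≢ o → height (o ∷ os) (s ℕ.+ q) ≡ 2 ℕ.* height os q
  height-shift-unchosen o os q ≢o rewrite height-shift o os q | dec-false (s ℕ.+ q ℕ.≟ o) ≢o = refl

  height-shift-≥ : ∀ {n} o (os : Vec ℕ n) q → 2 ℕ.* height os q ℕ.≤ height (o ∷ os) (s ℕ.+ q)
  height-shift-≥ o os q rewrite height-shift o os q = ℕ.m≤n+m (2 ℕ.* height os q) (if does (s ℕ.+ q ℕ.≟ o) then weight (o ∷ os) else 0)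

  -- A head `o < s` adds nothing at shifted positions, so its weight may be large; a head `o ≥ s`
  -- does add there and therefore has weight 1. Distinct doubled heights differ by at least 2, so an
  -- excess of 1 cannot disturb the strict maxima of the tail.
  height-shift-≤ : ∀ {n} o (os : Vec ℕ n) q → height (o ∷ os) (s ℕ.+ q) ℕ.≤ suc (2 ℕ.* height os q)
  height-shift-≤ o os q rewrite height-shift o os q with s ℕ.+ q ℕ.≟ o
  ... | no  ≢o   rewrite dec-false (s ℕ.+ q ℕ.≟ o) ≢o = ℕ.n≤1+n _
  ... | yes refl rewrite dec-true (o ℕ.≟ o) refl | dec-false (o ℕ.<? s) (ℕ.m+n≮m s q) = ℕ.≤-refl

  height-low-≤ : ∀ {n} (os : Vec ℕ n) p → p ℕ.< s → height os p ℕ.≤ weight os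
  height-low-≤ []       p p<s = ℕ.z≤n
  height-low-≤ (o ∷ os) p p<s with p ℕ.≟ o
  ... | no  p≢o  = subst (ℕ._≤ weight (o ∷ os)) (sym (height-unchosen o os p p≢o p<s)) ℕ.z≤n
  ... | yes refl rewrite dec-true (p ℕ.≟ p) refl | dec-false (s ℕ.≤? p) (ℕ.<⇒≱ p<s) =
    ℕ.≤-reflexive (ℕ.+-identityʳ _)

  -- Compatibility puts the head of the tail outside the overlap or at `o₁`, so no other overlap
  -- element is raised by it; and since `m ≤ s`, later intervals do not reach the overlap either.
  -- This is why weight 1 suffices for a head `o ≥ s`.
  overlap-unchosen : ∀ {n} o₁ (os : Vec ℕ n) r → Compatible (s ℕ.+ o₁) os → r ≢ o₁ → r ℕ.< m → height os r ≡ 0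
  overlap-unchosen o₁ []        r compat r≢ r<m = refl
  overlap-unchosen o₁ (o′ ∷ os) r compat r≢ r<m = height-unchosen o′ os r (r≢o′ compat) (ℕ.<-≤-trans r<m m≤s)
    where
    r≢o′ : Compatible (s ℕ.+ o₁) (o′ ∷ os) → r ≢ o′
    r≢o′ (inj₁ o<s)         refl = ℕ.m+n≮m s o₁ o<s
    r≢o′ (inj₂ (inj₁ m≤o′)) refl = ℕ.<⇒≱ r<m m≤o′
    r≢o′ (inj₂ (inj₂ eq))   refl = r≢ (sym (ℕ.+-cancelˡ-≡ s o₁ o′ eq))

  height-head : ∀ {n} o (os : Vec ℕ n) → Compatible o os → ∀ p → p ℕ.< k → p ≢ o →
                height (o ∷ os) p ℕ.< height (o ∷ os) o
  height-head o os compat p p<k p≢o with p ℕ.<? s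
  ... | yes p<s = subst (ℕ._< height (o ∷ os) o) (sym (height-unchosen o os p p≢o p<s))
    (ℕ.≤-trans (1≤weight o os) (height-chosen o os))
  ... | no p≮s with ℕ.m≤n⇒∃[o]m+o≡n (ℕ.≮⇒≥ p≮s)
  ... | r , refl = subst (ℕ._< height (o ∷ os) o) (sym (height-shift-unchosen o os r p≢o)) lemma
    where
    r<m : r ℕ.< m
    r<m = ℕ.+-cancelˡ-< s r m p<k

    lemma : 2 ℕ.* height os r ℕ.< height (o ∷ os) o
    lemma with o ℕ.<? s
    -- The value `suc (2 * weight os)` in `weight` is chosen for this case: positions of the overlap
    -- carry at most `2 * weight os`.
    ... | yes o<s = ℕ.≤-trans (ℕ.s≤s (ℕ.*-monoʳ-≤ 2 (height-low-≤ os r (ℕ.<-≤-trans r<m m≤s))))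
      (subst (ℕ._≤ height (o ∷ os) o)
        (cong (λ b → if b then suc (2 ℕ.* weight os) else 1) (dec-true (o ℕ.<? s) o<s)) (height-chosen o os))
    ... | no o≮s with ℕ.m≤n⇒∃[o]m+o≡n (ℕ.≮⇒≥ o≮s)
    ... | o₁ , refl = subst (λ h → 2 ℕ.* h ℕ.< height (o ∷ os) o)
      (sym (overlap-unchosen o₁ os r compat (λ r≡o₁ → p≢o (cong (s ℕ.+_) r≡o₁)) r<m))
      (ℕ.≤-trans (1≤weight o os) (height-chosen o os))

  height-maximal : ∀ {n} {os : Vec ℕ n} → Admissible os → ∀ i q → q ℕ.< k → q ≢ lookup os i →
    height os (s ℕ.* toℕ i ℕ.+ q) ℕ.< height os (s ℕ.* toℕ i ℕ.+ lookup os i)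
  height-maximal {os = o ∷ os} (cons o<k compat adm) zero q q<k q≢o
    rewrite ℕ.*-zeroʳ s = height-head o os compat q q<k q≢o
  height-maximal {os = o ∷ os} (cons o<k compat adm) (suc i) q q<k q≢
    rewrite ℕ.*-suc s (toℕ i) | ℕ.+-assoc s (s ℕ.* toℕ i) q | ℕ.+-assoc s (s ℕ.* toℕ i) (lookup os i) =
    begin-strict
      height (o ∷ os) (s ℕ.+ P)     ≤⟨ height-shift-≤ o os P ⟩
      suc (2 ℕ.* height os P)       <⟨ ℕ.n<1+n _ ⟩
      2 ℕ.+ 2 ℕ.* height os P       ≡⟨ ℕ.*-suc 2 (height os P) ⟨
      2 ℕ.* suc (height os P)       ≤⟨ ℕ.*-monoʳ-≤ 2 (height-maximal adm i q q<k q≢) ⟩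
      2 ℕ.* height os Q             ≤⟨ height-shift-≥ o os Q ⟩
      height (o ∷ os) (s ℕ.+ Q)     ∎
    where
    open ℕ.≤-Reasoning
    P = s ℕ.* toℕ i ℕ.+ q
    Q = s ℕ.* toℕ i ℕ.+ lookup os i

  -- Enumeration

  -- The value at [] is irrelevant: lower never contains the empty sequence.
  duplicate : ∀ {n} → Vec ℕ n → Vec ℕ (suc n)
  duplicate []       = 0 ∷ []
  duplicate (o ∷ os) = s ℕ.+ o ∷ o ∷ os

  -- The admissible sequences whose head is, respectively is not, less than m.
  lower upper sequences : ∀ n → List (Vec ℕ n)
  lower zero    = []
  lower (suc n) = cartesianProductWith _∷_ (upTo m) (sequences n)
  upper zero    = [] ∷ []
  -- Over a tail that is not low, all `s` heads from `m` on are allowed. Over a low tail the head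
  -- stays before the overlap, which leaves `s - m` values, or it is the very element chosen by the
  -- tail.
  upper (suc n) = cartesianProductWith _∷_ (applyUpTo (m ℕ.+_) s) (upper n)
               ++ cartesianProductWith _∷_ (applyUpTo (m ℕ.+_) (s ℕ.∸ m)) (lower n)
               ++ map duplicate (lower n)
  sequences n = lower n ++ upper n

  count : ℕ → ℕ
  count n = length (sequences n)

  Low : ∀ {n} → Vec ℕ n → Set
  Low []      = ⊥
  Low (o ∷ _) = o ℕ.< m

  lower-low : ∀ n {os} → os ∈ₗ lower n → Low os
  lower-low (suc n) os∈ with ∈-cartesianProductWith⁻ _∷_ (upTo m) (sequences n) os∈
  ... | _ , _ , o∈ , _ , refl = ∈-upTo⁻ o∈

  data Upper {n} : Vec ℕ (suc n) → Set where
    above : ∀ {i os} → i ℕ.< s → os ∈ₗ upper n → Upper (m ℕ.+ i ∷ os)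
    free  : ∀ {i os} → m ℕ.+ i ℕ.< s → os ∈ₗ lower n → Upper (m ℕ.+ i ∷ os)
    twice : ∀ {os} → os ∈ₗ lower n → Upper (duplicate os)

  upper⁻ : ∀ n {os} → os ∈ₗ upper (suc n) → Upper os
  upper⁻ n os∈ with ∈-++⁻ (cartesianProductWith _∷_ (applyUpTo (m ℕ.+_) s) (upper n)) os∈
  ... | inj₁ ∈₁ with ∈-cartesianProductWith⁻ _∷_ (applyUpTo (m ℕ.+_) s) (upper n) ∈₁
  ... | _ , _ , o∈ , os∈ , refl with ∈-applyUpTo⁻ (m ℕ.+_) o∈
  ... | _ , i<s , refl = above i<s os∈
  upper⁻ n os∈ | inj₂ ∈₂ with ∈-++⁻ (cartesianProductWith _∷_ (applyUpTo (m ℕ.+_) (s ℕ.∸ m)) (lower n)) ∈₂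
  ... | inj₁ ∈₃ with ∈-cartesianProductWith⁻ _∷_ (applyUpTo (m ℕ.+_) (s ℕ.∸ m)) (lower n) ∈₃
  ... | _ , _ , o∈ , os∈ , refl with ∈-applyUpTo⁻ (m ℕ.+_) o∈
  ... | i , i<s∸m , refl = free (subst (m ℕ.+ i ℕ.<_) (ℕ.m+[n∸m]≡n m≤s) (ℕ.+-monoʳ-< m i<s∸m)) os∈
  upper⁻ n os∈ | inj₂ ∈₂ | inj₂ ∈₄ with ∈-map⁻ duplicate ∈₄
  ... | _ , os∈ , refl = twice os∈

  upper-¬low : ∀ n {os} → os ∈ₗ upper n → ¬ Low os
  upper-¬low zero (here refl) ()
  upper-¬low (suc n) os∈ low with upper⁻ n os∈
  ... | above _ _ = ℕ.m+n≮m m _ low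
  ... | free _ _  = ℕ.m+n≮m m _ low
  ... | twice {[]} os∈′ = lower-low n os∈′
  ... | twice {o ∷ _} _ = ℕ.m+n≮m s o (ℕ.<-≤-trans low m≤s)

  compatible-¬low : ∀ {n} o (os : Vec ℕ n) → ¬ Low os → Compatible o os
  compatible-¬low o []       _    = tt
  compatible-¬low o (o′ ∷ _) ¬low = inj₂ (inj₁ (ℕ.≮⇒≥ ¬low))

  compatible-<s : ∀ {n} o (os : Vec ℕ n) → o ℕ.< s → Compatible o os
  compatible-<s o []       _   = tt
  compatible-<s o (o′ ∷ _) o<s = inj₁ o<s

  m+i<k : ∀ {i} → i ℕ.< s → m ℕ.+ i ℕ.< k
  m+i<k {i} i<s = subst (m ℕ.+ i ℕ.<_) (ℕ.+-comm m s) (ℕ.+-monoʳ-< m i<s)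

  <s⇒<k : ∀ {o} → o ℕ.< s → o ℕ.< k
  <s⇒<k o<s = ℕ.<-≤-trans o<s (ℕ.m≤m+n s m)

  -- A head below `m` is below `s`, hence before the overlap with the next interval and compatible
  -- with every tail; so `lower` may draw its tails from all of `sequences n`.
  lower-sound : ∀ n {os} → os ∈ₗ lower n → Admissible os
  upper-sound : ∀ n {os} → os ∈ₗ upper n → Admissible os
  sequences-sound : ∀ n {os} → os ∈ₗ sequences n → Admissible os

  lower-sound (suc n) os∈ with ∈-cartesianProductWith⁻ _∷_ (upTo m) (sequences n) os∈
  ... | o , os , o∈ , os∈′ , refl = cons (<s⇒<k o<s) (compatible-<s o os o<s) (sequences-sound n os∈′)
    where o<s = ℕ.<-≤-trans (∈-upTo⁻ o∈) m≤s

  upper-sound zero (here refl) = []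
  upper-sound (suc n) os∈ with upper⁻ n os∈
  ... | above i<s os∈′ = cons (m+i<k i<s) (compatible-¬low _ _ (upper-¬low n os∈′)) (upper-sound n os∈′)
  ... | free o<s os∈′  = cons (<s⇒<k o<s) (compatible-<s _ _ o<s) (lower-sound n os∈′)
  ... | twice {[]} os∈′ = ⊥-elim (lower-low n os∈′)
  ... | twice {_ ∷ _} os∈′ =
    cons (ℕ.+-monoʳ-< s (lower-low n os∈′)) (inj₂ (inj₂ refl)) (lower-sound n os∈′)

  sequences-sound n os∈ with ∈-++⁻ (lower n) os∈
  ... | inj₁ ∈lower = lower-sound n ∈lower
  ... | inj₂ ∈upper = upper-sound n ∈upper

  sequences-complete : ∀ {n} {os : Vec ℕ n} → Admissible os → os ∈ₗ sequences n
  sequences-complete [] = here refl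
  sequences-complete {suc n} (cons {o = o} {os = os} o<k compat adm)
    with o ℕ.<? m | sequences-complete adm
  ... | yes o<m | os∈ = ∈-++⁺ˡ (∈-cartesianProductWith⁺ _∷_ (∈-upTo⁺ o<m) os∈)
  ... | no  o≮m | os∈ with ℕ.m≤n⇒∃[o]m+o≡n (ℕ.≮⇒≥ o≮m) | ∈-++⁻ (lower n) os∈
  ... | i , refl | inj₂ os∈upper = ∈-++⁺ʳ (lower (suc n)) (∈-++⁺ˡ
    (∈-cartesianProductWith⁺ _∷_ (∈-applyUpTo⁺ (m ℕ.+_)
      (ℕ.+-cancelˡ-< m i s (subst (m ℕ.+ i ℕ.<_) (ℕ.+-comm s m) o<k))) os∈upper))
  ... | i , refl | inj₁ os∈lower =
    ∈-++⁺ʳ (lower (suc n)) (∈-++⁺ʳ (cartesianProductWith _∷_ (applyUpTo (m ℕ.+_) s) (upper n))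
      (go os compat os∈lower))
    where
    Rest = cartesianProductWith _∷_ (applyUpTo (m ℕ.+_) (s ℕ.∸ m)) (lower n)
    go : ∀ os → Compatible (m ℕ.+ i) os → os ∈ₗ lower n →
         (m ℕ.+ i ∷ os) ∈ₗ Rest ++ map duplicate (lower n)
    go []       _                  os∈ = ⊥-elim (lower-low n os∈)
    go (o ∷ os) (inj₁ o<s)         os∈ = ∈-++⁺ˡ (∈-cartesianProductWith⁺ _∷_ (∈-applyUpTo⁺ (m ℕ.+_)
      (ℕ.+-cancelˡ-< m i _ (subst (m ℕ.+ i ℕ.<_) (sym (ℕ.m+[n∸m]≡n m≤s)) o<s))) os∈)
    go (o ∷ os) (inj₂ (inj₁ m≤o))  os∈ = contradiction m≤o (ℕ.<⇒≱ (lower-low n os∈))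
    go (o ∷ os) (inj₂ (inj₂ eq))   os∈ = ∈-++⁺ʳ Rest
      (subst (λ p → (p ∷ o ∷ os) ∈ₗ map duplicate (lower n)) (sym eq) (∈-map⁺ duplicate os∈))

  duplicate-injective : ∀ {n} {os os′ : Vec ℕ n} → duplicate os ≡ duplicate os′ → os ≡ os′
  duplicate-injective {os = []}    {[]}    _  = refl
  duplicate-injective {os = _ ∷ _} {_ ∷ _} eq = ∷-injectiveʳ eq

  lower-unique : ∀ n → Unique (lower n)
  -- The first block differs from the other two in its tails, which are not low; the second differs
  -- from the third in its heads, which are below `s`.
  upper-unique : ∀ n → Unique (upper n)
  sequences-unique : ∀ n → Unique (sequences n)

  lower-unique zero    = []
  lower-unique (suc n) = Unique.cartesianProductWith⁺ _∷_ ∷-injective (Unique.upTo⁺ m) (sequences-unique n)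

  upper-unique zero    = All.[] ∷ []
  upper-unique (suc n) = Unique.++⁺ (prefixed s (upper-unique n))
    (Unique.++⁺ (prefixed (s ℕ.∸ m) (lower-unique n)) (Unique.map⁺ duplicate-injective (lower-unique n)) disjoint₂)
    disjoint₁
    where
    prefixed : ∀ l {xs : List (Vec ℕ n)} → Unique xs →
               Unique (cartesianProductWith _∷_ (applyUpTo (m ℕ.+_) l) xs)
    prefixed l = Unique.cartesianProductWith⁺ _∷_ ∷-injective
      (Unique.applyUpTo⁺₁ (m ℕ.+_) l (λ i<j _ eq → ℕ.<⇒≢ i<j (ℕ.+-cancelˡ-≡ m _ _ eq)))

    disjoint₂ : ∀ {os} → ¬ (os ∈ₗ cartesianProductWith _∷_ (applyUpTo (m ℕ.+_) (s ℕ.∸ m)) (lower n) ×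
                            os ∈ₗ map duplicate (lower n))
    disjoint₂ (p , q) with ∈-map⁻ duplicate q
    ... | []     , os∈ , refl = lower-low n os∈
    ... | o ∷ os , os∈ , refl with ∈-cartesianProductWith⁻ _∷_ (applyUpTo (m ℕ.+_) (s ℕ.∸ m)) (lower n) p
    ... | _ , _ , o∈ , _ , refl with ∈-applyUpTo⁻ (m ℕ.+_) o∈
    ... | i , i<s∸m , eq = ℕ.m+n≮m s o (subst (ℕ._< s) (sym eq)
      (subst (m ℕ.+ i ℕ.<_) (ℕ.m+[n∸m]≡n m≤s) (ℕ.+-monoʳ-< m i<s∸m)))

    disjoint₁ : ∀ {os} → ¬ (os ∈ₗ cartesianProductWith _∷_ (applyUpTo (m ℕ.+_) s) (upper n) ×
                            os ∈ₗ cartesianProductWith _∷_ (applyUpTo (m ℕ.+_) (s ℕ.∸ m)) (lower n)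
                               ++ map duplicate (lower n))
    disjoint₁ (p , q) with ∈-cartesianProductWith⁻ _∷_ (applyUpTo (m ℕ.+_) s) (upper n) p
    ... | _ , _ , _ , os∈ , refl
      with ∈-++⁻ (cartesianProductWith _∷_ (applyUpTo (m ℕ.+_) (s ℕ.∸ m)) (lower n)) q
    ... | inj₂ q₂ with ∈-map⁻ duplicate q₂
    ... | []    , os∈′ , refl = lower-low n os∈′
    ... | _ ∷ _ , os∈′ , refl = upper-¬low n os∈ (lower-low n os∈′)
    disjoint₁ (p , q) | _ , _ , _ , os∈ , refl | inj₁ q₁
      with ∈-cartesianProductWith⁻ _∷_ (applyUpTo (m ℕ.+_) (s ℕ.∸ m)) (lower n) q₁
    ... | _ , _ , _ , os∈′ , refl = upper-¬low n os∈ (lower-low n os∈′)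

  sequences-unique n = Unique.++⁺ (lower-unique n) (upper-unique n)
    λ (∈lower , ∈upper) → upper-¬low n ∈upper (lower-low n ∈lower)

  -- Counting the admissible sequences

  length-lower : ∀ n → length (lower (suc n)) ≡ m ℕ.* count n
  length-lower n = trans (length-cartesianProductWith _∷_ (upTo m) (sequences n))
    (cong (ℕ._* count n) (length-upTo m))

  length-upper : ∀ n → length (upper (suc n)) ≡
    s ℕ.* length (upper n) ℕ.+ ((s ℕ.∸ m) ℕ.* length (lower n) ℕ.+ length (lower n))
  length-upper n =
    trans (length-++ (prefixed s (upper n))) (cong₂ ℕ._+_ (length-prefixed s (upper n))
      (trans (length-++ (prefixed (s ℕ.∸ m) (lower n)))
        (cong₂ ℕ._+_ (length-prefixed (s ℕ.∸ m) (lower n)) (length-map duplicate (lower n)))))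
    where
    prefixed : ℕ → List (Vec ℕ n) → List (Vec ℕ (suc n))
    prefixed l = cartesianProductWith _∷_ (applyUpTo (m ℕ.+_) l)
    length-prefixed : ∀ l xs → length (prefixed l xs) ≡ l ℕ.* length xs
    length-prefixed l xs = trans (length-cartesianProductWith _∷_ (applyUpTo (m ℕ.+_) l) xs)
      (cong (ℕ._* length xs) (length-applyUpTo (m ℕ.+_) l))

  count-1 : count 1 ≡ k
  count-1 = begin
    count 1                                        ≡⟨ length-++ (lower 1) ⟩
    length (lower 1) ℕ.+ length (upper 1)          ≡⟨ cong₂ ℕ._+_ (length-lower 0) (length-upper 0) ⟩
    m ℕ.* 1 ℕ.+ (s ℕ.* 1 ℕ.+ ((s ℕ.∸ m) ℕ.* 0 ℕ.+ 0))
      ≡⟨ solve 3 (λ m s e → m :* con 1 :+ (s :* con 1 :+ (e :* con 0 :+ con 0)) := s :+ m) refl m s (s ℕ.∸ m) ⟩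
    k ∎
    where
    open ≡-Reasoning
    open ℕ-Solver.+-*-Solver

  -- b_{n+2} = k b_{n+1} - m (m - 1) b_n, with both sides moved so that no subtraction occurs.
  count-recurrence : ∀ n → count (2 ℕ.+ n) ℕ.+ m ℕ.* (m ℕ.* count n) ≡ k ℕ.* count (suc n) ℕ.+ m ℕ.* count n
  count-recurrence n = begin
    count (2 ℕ.+ n) ℕ.+ m ℕ.* (m ℕ.* count n)
      ≡⟨ cong₂ ℕ._+_
           (trans (length-++ (lower (2 ℕ.+ n))) (cong₂ ℕ._+_ (length-lower (suc n)) (length-upper (suc n))))
           (cong (m ℕ.*_) (sym (length-lower n))) ⟩
    m ℕ.* count (suc n) ℕ.+ (s ℕ.* u ℕ.+ (e ℕ.* l ℕ.+ l)) ℕ.+ m ℕ.* l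
      -- Writing `s` as `m + e` turns the truncated difference `s ∸ m` into a variable, and what
      -- remains is an identity in commutative semirings.
      ≡⟨ cong₂ (λ c s → m ℕ.* c ℕ.+ (s ℕ.* u ℕ.+ (e ℕ.* l ℕ.+ l)) ℕ.+ m ℕ.* l)
           (length-++ (lower (suc n))) (sym (ℕ.m+[n∸m]≡n m≤s)) ⟩
    m ℕ.* (l ℕ.+ u) ℕ.+ ((m ℕ.+ e) ℕ.* u ℕ.+ (e ℕ.* l ℕ.+ l)) ℕ.+ m ℕ.* l
      ≡⟨ solve 4 (λ m e l u → m :* (l :+ u) :+ ((m :+ e) :* u :+ (e :* l :+ l)) :+ m :* l
                              := (m :+ e :+ m) :* (l :+ u) :+ l) refl m e l u ⟩
    (m ℕ.+ e ℕ.+ m) ℕ.* (l ℕ.+ u) ℕ.+ l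
      ≡⟨ cong₂ (λ s c → (s ℕ.+ m) ℕ.* c ℕ.+ l) (ℕ.m+[n∸m]≡n m≤s) (sym (length-++ (lower (suc n)))) ⟩
    k ℕ.* count (suc n) ℕ.+ l
      ≡⟨ cong (k ℕ.* count (suc n) ℕ.+_) (length-lower n) ⟩
    k ℕ.* count (suc n) ℕ.+ m ℕ.* count n ∎
    where
    open ≡-Reasoning
    open ℕ-Solver.+-*-Solver
    e = s ℕ.∸ m
    l = length (lower (suc n))
    u = length (upper (suc n))

-- Generating function

module IntegerIdentities where

  open ℤ-Solver.+-*-Solver

  -- The denominator vanishes from degree 3 on, so beyond degree 2 the first term of the convolution
  -- is 0 and the rest is the convolution, one degree lower, with the shifted series.
  ⊛-denominator : ∀ k s f n → (f ⊛ denominator k s) (2 ℕ.+ n) ≡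
    f n ℤ.* coeff₂ k s ℤ.+ (f (1 ℕ.+ n) ℤ.* (ℤ.- + k) ℤ.+ (f (2 ℕ.+ n) ℤ.* + 1 ℤ.+ + 0))
  ⊛-denominator k s f zero    = refl
  ⊛-denominator k s f (suc n) = trans
    (cong₂ ℤ._+_ (ℤ.*-zeroʳ (f 0)) (⊛-denominator k s (λ i → f (suc i)) n)) (ℤ.+-identityˡ _)

  -- From degree 2 on, the coefficients of the product are the recurrence itself. Degree 2 involves
  -- the constant term 1 of the series, which is where `b 0 ≡ 1` enters.
  generating-function : ∀ k s (b : ℕ → ℕ) → b 0 ≡ 1 → b 1 ≡ k →
    (∀ n → + b (2 ℕ.+ n) ≡ + k ℤ.* + b (suc n) ℤ.- coeff₂ k s ℤ.* + b n) →
    (1+Σ b) IsInverseOf denominator k s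
  generating-function k s b b0 b1 rec zero = refl
  generating-function k s b b0 b1 rec (suc zero) rewrite b1 =
    solve 1 (λ k → con (+ 1) :* (:- k) :+ (k :* con (+ 1) :+ con (+ 0)) := con (+ 0)) refl (+ k)
  generating-function k s b b0 b1 rec (suc (suc n)) =
    trans (⊛-denominator k s (1+Σ b) n) (trans
      (cong₂ (λ x y → x ℤ.* C ℤ.+ (+ b (1 ℕ.+ n) ℤ.* (ℤ.- + k) ℤ.+ (y ℤ.* + 1 ℤ.+ + 0))) (term n) (rec n))
      (solve 4 (λ k c x y → x :* c :+ (y :* (:- k) :+ ((k :* y :- c :* x) :* con (+ 1) :+ con (+ 0))) := con (+ 0)) refl
        (+ k) C (+ b n) (+ b (suc n))))
    where
    C = coeff₂ k s
    term : ∀ n → (1+Σ b) n ≡ + b n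
    term zero    = cong +_ (sym b0)
    term (suc n) = refl

  module _ (s m : ℕ) (m≤s : m ℕ.≤ s) where

    open Offsets s m m≤s

    coeff₂≡ : coeff₂ k s ≡ + m ℤ.* + m ℤ.- + m
    coeff₂≡ = solve 2 (λ s m → (s :+ m :- s) :* (s :+ m :- s :- con (+ 1)) := m :* m :- m) refl (+ s) (+ m)

    count-recurrence-ℤ : ∀ n → + count (2 ℕ.+ n) ≡ + k ℤ.* + count (suc n) ℤ.- coeff₂ k s ℤ.* + count n
    count-recurrence-ℤ n = begin
      X                                            ≡⟨ solve 2 (λ x y → x := (x :+ y) :- y) refl X (M ℤ.* (M ℤ.* C)) ⟩
      X ℤ.+ M ℤ.* (M ℤ.* C) ℤ.- M ℤ.* (M ℤ.* C)    ≡⟨ cong (ℤ._- M ℤ.* (M ℤ.* C)) recurrence ⟩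
      + k ℤ.* C′ ℤ.+ M ℤ.* C ℤ.- M ℤ.* (M ℤ.* C)
        ≡⟨ solve 4 (λ k c′ m c → k :* c′ :+ m :* c :- m :* (m :* c) := k :* c′ :- (m :* m :- m) :* c) refl (+ k) C′ M C ⟩
      + k ℤ.* C′ ℤ.- (M ℤ.* M ℤ.- M) ℤ.* C         ≡⟨ cong (λ c → + k ℤ.* C′ ℤ.- c ℤ.* C) coeff₂≡ ⟨
      + k ℤ.* C′ ℤ.- coeff₂ k s ℤ.* C              ∎
      where
      open ≡-Reasoning
      X = + count (2 ℕ.+ n)
      M = + m
      C = + count n
      C′ = + count (suc n)
      recurrence : X ℤ.+ M ℤ.* (M ℤ.* C) ≡ + k ℤ.* C′ ℤ.+ M ℤ.* C
      recurrence = begin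
        X ℤ.+ M ℤ.* (M ℤ.* C)
          ≡⟨ cong (λ y → X ℤ.+ y) (trans (ℤ.pos-* m (m ℕ.* count n)) (cong (M ℤ.*_) (ℤ.pos-* m (count n)))) ⟨
        + (count (2 ℕ.+ n) ℕ.+ m ℕ.* (m ℕ.* count n))      ≡⟨ cong +_ (count-recurrence n) ⟩
        + (k ℕ.* count (suc n)) ℤ.+ + (m ℕ.* count n)      ≡⟨ cong₂ ℤ._+_ (ℤ.pos-* k (count (suc n))) (ℤ.pos-* m (count n)) ⟩
        + k ℤ.* C′ ℤ.+ M ℤ.* C                             ∎

    shifted-recurrence : ∀ n →
      + count (n ℕ.+ 2) ℤ.- + k ℤ.* + count (n ℕ.+ 1) ℤ.+ coeff₂ k s ℤ.* + count n ≡ + 0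
    shifted-recurrence n = begin
      + count (n ℕ.+ 2) ℤ.- + k ℤ.* + count (n ℕ.+ 1) ℤ.+ Y
        ≡⟨ cong₂ (λ i j → + count i ℤ.- + k ℤ.* + count j ℤ.+ Y) (ℕ.+-comm n 2) (ℕ.+-comm n 1) ⟩
      + count (2 ℕ.+ n) ℤ.- X ℤ.+ Y  ≡⟨ cong (λ z → z ℤ.- X ℤ.+ Y) (count-recurrence-ℤ n) ⟩
      X ℤ.- Y ℤ.- X ℤ.+ Y            ≡⟨ solve 2 (λ x y → x :- y :- x :+ y := con (+ 0)) refl X Y ⟩
      + 0                            ∎
      where
      open ≡-Reasoning
      X = + k ℤ.* + count (suc n)
      Y = coeff₂ k s ℤ.* + count n

    count-2 : + count 2 ≡ (+ k) ℤ.^ 2 ℤ.- coeff₂ k s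
    count-2 = trans (count-recurrence-ℤ 0) (trans (cong (λ b → + k ℤ.* + b ℤ.- coeff₂ k s ℤ.* + 1) count-1)
      (solve 2 (λ k c → k :* k :- c :* con (+ 1) := k :* (k :* con (+ 1)) :- c) refl (+ k) (coeff₂ k s)))

    -- With `s = m + e` the discriminant becomes `4 m e + e² + 4 m`, a natural number that vanishes
    -- only for `m = e = 0`, that is for `k = 0`. The bound `1 ≤ D` later keeps the two roots apart.
    positive-discriminant : 1 ℕ.≤ k → ∃ λ D → 1 ℕ.≤ D × + D ≡ (+ k) ℤ.^ 2 ℤ.- + 4 ℤ.* coeff₂ k s
    positive-discriminant 1≤k with ℕ.m≤n⇒∃[o]m+o≡n m≤s
    ... | e , eq = D , 1≤D m e (subst (λ s → 1 ℕ.≤ s ℕ.+ m) (sym eq) 1≤k) , (begin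
      + D
        ≡⟨ cong₂ ℤ._+_ (cong₂ ℤ._+_ (trans (ℤ.pos-* 4 (m ℕ.* e)) (cong (+ 4 ℤ.*_) (ℤ.pos-* m e))) (ℤ.pos-* e e))
             (ℤ.pos-* 4 m) ⟩
      + 4 ℤ.* (+ m ℤ.* + e) ℤ.+ + e ℤ.* + e ℤ.+ + 4 ℤ.* + m
        ≡⟨ solve 2 (λ m e → con (+ 4) :* (m :* e) :+ e :* e :+ con (+ 4) :* m :=
             (m :+ e :+ m) :* ((m :+ e :+ m) :* con (+ 1)) :- con (+ 4) :* (m :* m :- m)) refl (+ m) (+ e) ⟩
      (+ (m ℕ.+ e ℕ.+ m)) ℤ.^ 2 ℤ.- + 4 ℤ.* (+ m ℤ.* + m ℤ.- + m)
        ≡⟨ cong₂ (λ s c → (+ (s ℕ.+ m)) ℤ.^ 2 ℤ.- + 4 ℤ.* c) eq (sym coeff₂≡) ⟩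
      (+ k) ℤ.^ 2 ℤ.- + 4 ℤ.* coeff₂ k s ∎)
      where
      open ≡-Reasoning
      D = 4 ℕ.* (m ℕ.* e) ℕ.+ e ℕ.* e ℕ.+ 4 ℕ.* m
      1≤D : ∀ m e → 1 ℕ.≤ m ℕ.+ e ℕ.+ m → 1 ℕ.≤ 4 ℕ.* (m ℕ.* e) ℕ.+ e ℕ.* e ℕ.+ 4 ℕ.* m
      1≤D zero    (suc e) _ = ℕ.s≤s ℕ.z≤n
      1≤D (suc m) e       _ = ℕ.m≤n⇒m≤o+n _ (ℕ.s≤s ℕ.z≤n)

  ⌈s+m/2⌉≤s⇒m≤s : ∀ s m → ⌈ s ℕ.+ m /2⌉ ℕ.≤ s → m ℕ.≤ s
  ⌈s+m/2⌉≤s⇒m≤s s m le = ℕ.+-cancelˡ-≤ s m s (begin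
    s ℕ.+ m                                    ≡⟨ ℕ.⌊n/2⌋+⌈n/2⌉≡n (s ℕ.+ m) ⟨
    ⌊ s ℕ.+ m /2⌋ ℕ.+ ⌈ s ℕ.+ m /2⌉            ≤⟨ ℕ.+-mono-≤ (ℕ.≤-trans (ℕ.⌊n/2⌋≤⌈n/2⌉ (s ℕ.+ m)) le) le ⟩
    s ℕ.+ s                                    ∎)
    where open ℕ.≤-Reasoning

open IntegerIdentities
open ℚ-Solver.+-*-Solver using (solve; _:+_; _:*_; :-_; _:-_; _:=_; con)

-- Rational inequalities and the ring structure of the reals

∣p∣≤q : ∀ p q → p ℚ.≤ q → ℚ.- p ℚ.≤ q → ∣ p ∣ ℚ.≤ q
∣p∣≤q p q p≤q -p≤q with ℚ.∣p∣≡p∨∣p∣≡-p p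
... | inj₁ eq = subst (ℚ._≤ q) (sym eq) p≤q
... | inj₂ eq = subst (ℚ._≤ q) (sym eq) -p≤q

p-q≤r⇒p≤q+r : ∀ p q r → p ℚ.- q ℚ.≤ r → p ℚ.≤ q ℚ.+ r
p-q≤r⇒p≤q+r p q r le = subst (ℚ._≤ q ℚ.+ r)
  (solve 2 (λ p q → q :+ (p :- q) := p) refl p q) (ℚ.+-monoʳ-≤ q le)

p≤q+r⇒p-q≤r : ∀ p q r → p ℚ.≤ q ℚ.+ r → p ℚ.- q ℚ.≤ r
p≤q+r⇒p-q≤r p q r le = subst (p ℚ.- q ℚ.≤_)
  (solve 2 (λ q r → q :+ r :- q := r) refl q r) (ℚ.+-monoˡ-≤ (ℚ.- q) le)

module _ {P Q : ℕ → Set} where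

  both : Eventually P → Eventually Q → Eventually (λ n → P n × Q n)
  both (M , f) (N , g) = M ℕ.⊔ N , λ n le →
    f n (ℕ.m⊔n≤o⇒m≤o M N le) , g n (ℕ.m⊔n≤o⇒n≤o M N le)

  eventually-map : (∀ n → P n → Q n) → Eventually P → Eventually Q
  eventually-map h (N , f) = N , λ n le → h n (f n le)

-- The ring operations act termwise, so a polynomial identity between reals follows from the
-- rational one at every index. This is how the solver for ℚ proves identities in ℝ.
≗⇒≈ : ∀ {x y} → (∀ n → seq x n ≡ seq y n) → x ≈ y
≗⇒≈ {x} {y} eq = mk≈ λ ε 0<ε → 0 , λ n _ →
  subst (ℚ._≤ ε) (sym (trans (cong (λ z → ∣ z ℚ.- seq y n ∣) (eq n)) (∣p-p∣≡0 (seq y n)))) (ℚ.<⇒≤ 0<ε)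

abstract

  +-cong : ∀ {x y u v} → x ≈ y → u ≈ v → x + u ≈ y + v
  +-cong {x} {y} {u} {v} (mk≈ x≈y) (mk≈ u≈v) = mk≈ λ ε 0<ε →
    eventually-map (λ n (p , q) → subst₂ ℚ._≤_
        (cong ∣_∣ (sum-of-differences (seq x n) (seq y n) (seq u n) (seq v n)))
        (half+half ε)
        (ℚ.≤-trans (ℚ.∣p+q∣≤∣p∣+∣q∣ (seq x n ℚ.- seq y n) (seq u n ℚ.- seq v n)) (ℚ.+-mono-≤ p q)))
      (both (x≈y (ε ℚ.* ½) (half>0 ε 0<ε)) (u≈v (ε ℚ.* ½) (half>0 ε 0<ε)))

  *-cong : ∀ {x y u v} → x ≈ y → u ≈ v → x * u ≈ y * v
  *-cong {x} {y} {u} {v} (mk≈ x≈y) (mk≈ u≈v) = mk≈ λ ε 0<ε →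
    let A , 0<A , x≤A = cauchy-bound (seq x) (cauchy x)
        B , 0<B , v≤B = cauchy-bound (seq v) (cauchy v)
    in eventually-map (λ n ((x≤ , v≤) , (xy , uv)) →
          products-close ε A B (seq x n) (seq y n) (seq u n) (seq v n) 0<ε 0<A 0<B x≤ v≤ uv xy)
      (both (both x≤A v≤B)
            (both (x≈y (scaled ε B) (scaled>0 ε B 0<ε 0<B)) (u≈v (scaled ε A) (scaled>0 ε A 0<ε 0<A))))

  neg-cong : ∀ {x y} → x ≈ y → - x ≈ - y
  neg-cong {x} {y} (mk≈ x≈y) = mk≈ λ ε 0<ε →
    eventually-map (λ n → subst (ℚ._≤ ε)
        (trans (∣p-q∣≡∣q-p∣ (seq x n) (seq y n)) (cong ∣_∣ (swap-neg (seq x n) (seq y n)))))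
      (x≈y ε 0<ε)

ℝ-commutativeRing : CommutativeRing 0ℓ 0ℓ
ℝ-commutativeRing = record
  { Carrier = ℝ ; _≈_ = _≈_ ; _+_ = _+_ ; _*_ = _*_ ; -_ = -_ ; 0# = 0ℝ ; 1# = 1ℝ
  ; isCommutativeRing = record
    { isRing = record
      { +-isAbelianGroup = record
        { isGroup = record
          { isMonoid = record
            { isSemigroup = record
              { isMagma = record
                { isEquivalence = record { refl = ≈-refl ; sym = ≈-sym ; trans = ≈-trans }
                ; ∙-cong = +-cong
                }
              ; assoc = λ x y z → ≗⇒≈ λ n → ℚ.+-assoc (seq x n) (seq y n) (seq z n)
              }
            ; identity = (λ x → ≗⇒≈ λ n → ℚ.+-identityˡ (seq x n))
                       , (λ x → ≗⇒≈ λ n → ℚ.+-identityʳ (seq x n))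
            }
          ; inverse = (λ x → ≗⇒≈ λ n → ℚ.+-inverseˡ (seq x n))
                    , (λ x → ≗⇒≈ λ n → ℚ.+-inverseʳ (seq x n))
          ; ⁻¹-cong = neg-cong
          }
        ; comm = λ x y → ≗⇒≈ λ n → ℚ.+-comm (seq x n) (seq y n)
        }
      ; *-cong = *-cong
      ; *-assoc = λ x y z → ≗⇒≈ λ n → ℚ.*-assoc (seq x n) (seq y n) (seq z n)
      ; *-identity = (λ x → ≗⇒≈ λ n → ℚ.*-identityˡ (seq x n))
                   , (λ x → ≗⇒≈ λ n → ℚ.*-identityʳ (seq x n))
      ; distrib = (λ x y z → ≗⇒≈ λ n → ℚ.*-distribˡ-+ (seq x n) (seq y n) (seq z n))
                , (λ x y z → ≗⇒≈ λ n → ℚ.*-distribʳ-+ (seq x n) (seq y n) (seq z n))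
      }
    ; *-comm = λ x y → ≗⇒≈ λ n → ℚ.*-comm (seq x n) (seq y n)
    }
  }

open CommutativeRing ℝ-commutativeRing
  using (+-identityˡ; +-identityʳ; +-comm; +-assoc; *-identityˡ; *-identityʳ; *-assoc;
         -‿inverseʳ; zeroˡ; zeroʳ; semiring; distribˡ)
  renaming (reflexive to ≈-reflexive)
open import Algebra.Properties.Semiring.Sum semiring
  using (*-distribˡ-sum; *-distribʳ-sum; ∑-comm; ∑-distrib-+; sum-cong-≋; sum-replicate-zero)
module ≈-Reasoning = Relation.Binary.Reasoning.Setoid ℝ-setoid

-- Order

abstract

  ≈⇒≤ : ∀ {x y} → x ≈ y → x ≤ y
  ≈⇒≤ {x} {y} (mk≈ x≈y) = mk≤ λ ε 0<ε → eventually-map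
    (λ n le → p-q≤r⇒p≤q+r (seq x n) (seq y n) ε (ℚ.≤-trans (p≤∣p∣ _) le)) (x≈y ε 0<ε)

  ≤-trans : ∀ {x y z} → x ≤ y → y ≤ z → x ≤ z
  ≤-trans {x} {y} {z} (mk≤ x≤y) (mk≤ y≤z) = mk≤ λ ε 0<ε → eventually-map
    (λ n (p , q) → subst (seq x n ℚ.≤_)
      (trans (ℚ.+-assoc (seq z n) (ε ℚ.* ½) (ε ℚ.* ½)) (cong (seq z n ℚ.+_) (half+half ε)))
      (ℚ.≤-trans p (ℚ.+-monoˡ-≤ (ε ℚ.* ½) q)))
    (both (x≤y (ε ℚ.* ½) (half>0 ε 0<ε)) (y≤z (ε ℚ.* ½) (half>0 ε 0<ε)))

  ≤-antisym : ∀ {x y} → x ≤ y → y ≤ x → x ≈ y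
  ≤-antisym {x} {y} (mk≤ x≤y) (mk≤ y≤x) = mk≈ λ ε 0<ε → eventually-map
    (λ n (p , q) → ∣p∣≤q _ ε (p≤q+r⇒p-q≤r (seq x n) (seq y n) ε p)
      (subst (ℚ._≤ ε) (solve 2 (λ x y → y :- x := :- (x :- y)) refl (seq x n) (seq y n))
        (p≤q+r⇒p-q≤r (seq y n) (seq x n) ε q)))
    (both (x≤y ε 0<ε) (y≤x ε 0<ε))

  +-mono-≤ : ∀ {x y u v} → x ≤ y → u ≤ v → x + u ≤ y + v
  +-mono-≤ {x} {y} {u} {v} (mk≤ x≤y) (mk≤ u≤v) = mk≤ λ ε 0<ε → eventually-map
    (λ n (p , q) → subst (seq x n ℚ.+ seq u n ℚ.≤_)
      (trans (solve 3 (λ y v e → (y :+ e) :+ (v :+ e) := (y :+ v) :+ (e :+ e)) refl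
               (seq y n) (seq v n) (ε ℚ.* ½))
             (cong (seq y n ℚ.+ seq v n ℚ.+_) (half+half ε)))
      (ℚ.+-mono-≤ p q))
    (both (x≤y (ε ℚ.* ½) (half>0 ε 0<ε)) (u≤v (ε ℚ.* ½) (half>0 ε 0<ε)))

  private

    -- The terms of a nonnegative real may dip below 0. The two bounds on `p` give
    -- `∣ p ∣ ≤ scaled ε C`, so such a dip makes the product at most ε/2 in absolute value.
    small-product : ∀ ε C p q → 0ℚ ℚ.< ε → 0ℚ ℚ.< C → 0ℚ ℚ.≤ p ℚ.+ scaled ε C → p ℚ.≤ 0ℚ →
                    ∣ q ∣ ℚ.≤ C → 0ℚ ℚ.≤ q ℚ.* p ℚ.+ ε
    small-product ε C p q 0<ε 0<C 0≤p+ p≤0 q≤C =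
      subst₂ ℚ._≤_ (ℚ.+-inverseʳ (q ℚ.* p)) refl (ℚ.+-monoʳ-≤ (q ℚ.* p)
        (ℚ.≤-trans (p≤∣p∣ (ℚ.- (q ℚ.* p))) (ℚ.≤-trans (ℚ.≤-reflexive (ℚ.∣-p∣≡∣p∣ (q ℚ.* p)))
          (ℚ.≤-trans (product-bound ε C q p 0<ε 0<C q≤C
              (∣p∣≤q p _ (ℚ.≤-trans p≤0 (ℚ.<⇒≤ (scaled>0 ε C 0<ε 0<C)))
                (subst (ℚ._≤ scaled ε C) (ℚ.+-identityˡ (ℚ.- p)) (p≤q+r⇒p-q≤r 0ℚ p _ 0≤p+))))
            (subst (ε ℚ.* ½ ℚ.≤_) (ℚ.*-identityʳ ε)
              (ℚ.*-monoˡ-≤-nonNeg ε {{ℚ.nonNegative (ℚ.<⇒≤ 0<ε)}} (ℚ.≤ᵇ⇒≤ _)))))))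

  *-nonneg : ∀ {x y} → 0ℝ ≤ x → 0ℝ ≤ y → 0ℝ ≤ x * y
  *-nonneg {x} {y} (mk≤ 0≤x) (mk≤ 0≤y) = mk≤ λ ε 0<ε →
    let A , 0<A , x≤A = cauchy-bound (seq x) (cauchy x)
        B , 0<B , y≤B = cauchy-bound (seq y) (cauchy y)
    in eventually-map (λ n ((x≤ , y≤) , (p , q)) → lemma ε 0<ε A B 0<A 0<B (seq x n) (seq y n) x≤ y≤ p q)
      (both (both x≤A y≤B)
            (both (0≤x (scaled ε B) (scaled>0 ε B 0<ε 0<B)) (0≤y (scaled ε A) (scaled>0 ε A 0<ε 0<A))))
    where
    lemma : ∀ ε → 0ℚ ℚ.< ε → ∀ A B → 0ℚ ℚ.< A → 0ℚ ℚ.< B → ∀ a b → ∣ a ∣ ℚ.≤ A → ∣ b ∣ ℚ.≤ B →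
            0ℚ ℚ.≤ a ℚ.+ scaled ε B → 0ℚ ℚ.≤ b ℚ.+ scaled ε A → 0ℚ ℚ.≤ a ℚ.* b ℚ.+ ε
    lemma ε 0<ε A B 0<A 0<B a b a≤A b≤B p q with ℚ.≤-total 0ℚ a | ℚ.≤-total 0ℚ b
    ... | inj₂ a≤0 | _ = subst (λ z → 0ℚ ℚ.≤ z ℚ.+ ε) (ℚ.*-comm b a) (small-product ε B a b 0<ε 0<B p a≤0 b≤B)
    ... | inj₁ _   | inj₂ b≤0 = small-product ε A b a 0<ε 0<A q b≤0 a≤A
    ... | inj₁ 0≤a | inj₁ 0≤b = ℚ.+-mono-≤ {0ℚ} {a ℚ.* b} {0ℚ} {ε}
      (ℚ.≤-trans (ℚ.≤-reflexive (sym (ℚ.*-zeroʳ a))) (ℚ.*-monoˡ-≤-nonNeg a {{ℚ.nonNegative 0≤a}} 0≤b)) (ℚ.<⇒≤ 0<ε)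

≤-refl : ∀ {x} → x ≤ x
≤-refl = ≈⇒≤ ≈-refl

≤-respʳ : ∀ {x y z} → x ≤ y → y ≈ z → x ≤ z
≤-respʳ x≤y y≈z = ≤-trans x≤y (≈⇒≤ y≈z)

≤-respˡ : ∀ {x y z} → x ≈ y → y ≤ z → x ≤ z
≤-respˡ x≈y y≤z = ≤-trans (≈⇒≤ x≈y) y≤z

x≤y⇒0≤y-x : ∀ {x y} → x ≤ y → 0ℝ ≤ y - x
x≤y⇒0≤y-x {x} x≤y = ≤-respˡ (≈-sym (-‿inverseʳ x)) (+-mono-≤ x≤y (≤-refl { - x}))

x-y≈0⇒x≈y : ∀ {x y} → x - y ≈ 0ℝ → x ≈ y
x-y≈0⇒x≈y {x} {y} eq = ≈-trans (≗⇒≈ λ n → solve 2 (λ x y → x := (x :- y) :+ y) refl (seq x n) (seq y n))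
  (≈-trans (+-cong eq ≈-refl) (+-identityˡ y))

0≤y-x⇒x≤y : ∀ {x y} → 0ℝ ≤ y - x → x ≤ y
0≤y-x⇒x≤y {x} {y} 0≤ = ≤-respˡ (≈-sym (+-identityˡ x)) (≤-respʳ (+-mono-≤ 0≤ (≤-refl {x}))
  (≗⇒≈ λ n → solve 2 (λ x y → (y :- x) :+ x := y) refl (seq x n) (seq y n)))

+-cancelʳ-≈ : ∀ {x y} z → x + z ≈ y + z → x ≈ y
+-cancelʳ-≈ {x} {y} z eq = x-y≈0⇒x≈y (≈-trans
  (≗⇒≈ λ n → solve 3 (λ x y z → x :- y := (x :+ z) :- (y :+ z)) refl (seq x n) (seq y n) (seq z n))
  (≈-trans (+-cong eq ≈-refl) (-‿inverseʳ (y + z))))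

+-cancelʳ-≤ : ∀ {x y} z → x + z ≤ y + z → x ≤ y
+-cancelʳ-≤ {x} {y} z le = ≤-respˡ (cancel x) (≤-respʳ (+-mono-≤ le (≤-refl { - z})) (≈-sym (cancel y)))
  where
  cancel : ∀ x → x ≈ x + z - z
  cancel x = ≗⇒≈ λ n → solve 2 (λ x z → x := (x :+ z) :- z) refl (seq x n) (seq z n)

abstract

  <⇒≤ : ∀ {x y} → x < y → x ≤ y
  <⇒≤ {x} {y} (mk< g 0<g below) = mk≤ λ ε 0<ε → eventually-map
    (λ n le → ℚ.≤-trans (ℚ.≤-trans (ℚ.≤-reflexive (sym (ℚ.+-identityʳ (seq x n))))
                (ℚ.≤-trans (ℚ.+-monoʳ-≤ (seq x n) (ℚ.<⇒≤ 0<g)) le))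
      (ℚ.≤-trans (ℚ.≤-reflexive (sym (ℚ.+-identityʳ (seq y n)))) (ℚ.+-monoʳ-≤ (seq y n) (ℚ.<⇒≤ 0<ε)))) below

  <-irrefl : ∀ {x y} → x ≈ y → ¬ x < y
  <-irrefl {x} {y} (mk≈ x≈y) (mk< g 0<g below) =
    let N , f = both (x≈y (g ℚ.* ½) (half>0 g 0<g)) below
        p , q = f N ℕ.≤-refl
        g≤ : g ℚ.≤ g ℚ.* ½
        g≤ = ℚ.≤-trans (ℚ.≤-trans (ℚ.≤-reflexive (solve 2 (λ x g → g := (x :+ g) :- x) refl (seq x N) g))
               (ℚ.+-monoˡ-≤ (ℚ.- seq x N) q))
             (ℚ.≤-trans (p≤∣p∣ _) (subst (ℚ._≤ g ℚ.* ½) (∣p-q∣≡∣q-p∣ (seq x N) (seq y N)) p))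
    in ℚ.<-irrefl refl (ℚ.<-≤-trans (ℚ.+-mono-<-≤ (half>0 g 0<g) (ℚ.≤-refl {g ℚ.* ½}))
         (ℚ.≤-trans (ℚ.≤-reflexive (half+half g)) (ℚ.≤-trans g≤ (ℚ.≤-reflexive (sym (ℚ.+-identityˡ _))))))

  <-≤-trans : ∀ {x y z} → x < y → y ≤ z → x < z
  <-≤-trans {x} {y} {z} (mk< g 0<g below) (mk≤ y≤z) = mk< (g ℚ.* ½) (half>0 g 0<g) (eventually-map
    (λ n (p , q) → subst₂ ℚ._≤_
      (trans (cong (λ g → seq x n ℚ.+ g ℚ.- e) (sym (half+half g)))
        (solve 2 (λ x e → x :+ (e :+ e) :- e := x :+ e) refl (seq x n) e))
      (solve 2 (λ z e → z :+ e :- e := z) refl (seq z n) e)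
      (ℚ.+-monoˡ-≤ (ℚ.- e) (ℚ.≤-trans p q)))
    (both below (y≤z e (half>0 g 0<g))))
    where
    e : ℚ
    e = g ℚ.* ½

  -- Testing one rational term is enough. Beyond `N ⊔ M` the terms of `x` vary by at most g/4; if
  -- the tested one is at least g/2, then `x` stays above g/4, and otherwise `x` stays below 3g/4,
  -- which leaves at least g/4 for `y`.
  0<x+y⇒0<x⊎0<y : ∀ {x y} → 0ℝ < x + y → 0ℝ < x ⊎ 0ℝ < y
  0<x+y⇒0<x⊎0<y {x} {y} (mk< g 0<g (N , below))
    with cauchy x (g ℚ.* ½ ℚ.* ½) (half>0 _ (half>0 g 0<g))
  ... | M , close with ℚ.≤-total (g ℚ.* ½) (seq x (N ℕ.⊔ M))
  ... | inj₁ h≤x = inj₁ (mk< e (half>0 _ (half>0 g 0<g)) (N ℕ.⊔ M , λ n le →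
      ℚ.≤-trans (ℚ.≤-trans (ℚ.≤-reflexive (trans (ℚ.+-identityˡ e)
          (trans (solve 1 (λ e → e := (e :+ e) :- e) refl e) (cong (ℚ._- e) (half+half (g ℚ.* ½))))))
        (ℚ.+-monoˡ-≤ (ℚ.- e) h≤x))
        (p≤q+r⇒p-q≤r (seq x (N ℕ.⊔ M)) e (seq x n)
          (subst (seq x (N ℕ.⊔ M) ℚ.≤_) (ℚ.+-comm (seq x n) e)
            (p-q≤r⇒p≤q+r _ (seq x n) e (ℚ.≤-trans (p≤∣p∣ _)
              (close (N ℕ.⊔ M) n (ℕ.m≤n⊔m N M) (ℕ.m⊔n≤o⇒n≤o N M le))))))))
    where
    e : ℚ
    e = g ℚ.* ½ ℚ.* ½
  ... | inj₂ x≤h = inj₂ (mk< e (half>0 _ (half>0 g 0<g)) (N ℕ.⊔ M , λ n le →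
      let x≤ : seq x n ℚ.≤ g ℚ.* ½ ℚ.+ e
          x≤ = ℚ.≤-trans (p-q≤r⇒p≤q+r (seq x n) (seq x (N ℕ.⊔ M)) e (ℚ.≤-trans (p≤∣p∣ _)
                 (close n (N ℕ.⊔ M) (ℕ.m⊔n≤o⇒n≤o N M le) (ℕ.m≤n⊔m N M)))) (ℚ.+-monoˡ-≤ e x≤h)
      in subst₂ ℚ._≤_
        (trans (cong (λ g′ → (0ℚ ℚ.+ g′) ℚ.- (g ℚ.* ½ ℚ.+ e)) (sym (half+half g)))
          (trans (cong (λ h → (0ℚ ℚ.+ (h ℚ.+ h)) ℚ.- (h ℚ.+ e)) (sym (half+half (g ℚ.* ½))))
            (solve 2 (λ z e → (z :+ ((e :+ e) :+ (e :+ e))) :- ((e :+ e) :+ e) := z :+ e) refl 0ℚ e)))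
        (solve 2 (λ x y → (x :+ y) :- x := y) refl (seq x n) (seq y n))
        (ℚ.+-mono-≤ (below n (ℕ.m⊔n≤o⇒m≤o N M le)) (ℚ.neg-antimono-≤ x≤))))
    where
    e : ℚ
    e = g ℚ.* ½ ℚ.* ½

  inv-inverseʳ : ∀ x (x#0 : x # 0ℝ) → x * inv x x#0 ≈ 1ℝ
  inv-inverseʳ x x#0 = mk≈ λ ε 0<ε →
    let δ , 0<δ , away = #0⇒bounded-away x x#0 in
    eventually-map (λ n δ≤ → subst (ℚ._≤ ε)
      (trans (sym (∣p-p∣≡0 1ℚ)) (cong (λ z → ∣ z ℚ.- 1ℚ ∣) (sym (recip-inverseʳ (seq x n)
        (λ x≡0 → ℚ.<-irrefl refl (ℚ.<-≤-trans 0<δ (subst (λ z → δ ℚ.≤ ∣ z ∣) x≡0 δ≤)))))))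
      (ℚ.<⇒≤ 0<ε)) away

0<1 : 0ℝ < 1ℝ
0<1 = mk< 1ℚ (ℚ.positive⁻¹ 1ℚ) (0 , λ _ _ → ℚ.≤-refl)

x*y≈0⇒y≈0 : ∀ {x y} → x # 0ℝ → x * y ≈ 0ℝ → y ≈ 0ℝ
x*y≈0⇒y≈0 {x} {y} x#0 eq = begin
  y                       ≈⟨ *-identityˡ y ⟨
  1ℝ * y                  ≈⟨ *-cong (inv-inverseʳ x x#0) ≈-refl ⟨
  (x * inv x x#0) * y     ≈⟨ ≗⇒≈ (λ n → solve 3 (λ x i y → (x :* i) :* y := i :* (x :* y)) refl
                                (seq x n) (seq (inv x x#0) n) (seq y n)) ⟩
  inv x x#0 * (x * y)     ≈⟨ *-cong ≈-refl eq ⟩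
  inv x x#0 * 0ℝ          ≈⟨ zeroʳ _ ⟩
  0ℝ                      ∎
  where open ≈-Reasoning

x<y⇒0<y-x : ∀ {x y} → x < y → 0ℝ < y - x
x<y⇒0<y-x {x} {y} (mk< g 0<g below) = mk< g 0<g (eventually-map (λ n le → subst (ℚ._≤ seq y n ℚ.- seq x n)
  (trans (solve 2 (λ x g → (x :+ g) :- x := g) refl (seq x n) g) (sym (ℚ.+-identityˡ g)))
  (ℚ.+-monoˡ-≤ (ℚ.- seq x n) le)) below)

0<y-x⇒x<y : ∀ {x y} → 0ℝ < y - x → x < y
0<y-x⇒x<y {x} {y} (mk< g 0<g below) = mk< g 0<g (eventually-map (λ n le → subst₂ ℚ._≤_
  (trans (cong (ℚ._+ seq x n) (ℚ.+-identityˡ g)) (ℚ.+-comm g (seq x n)))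
  (solve 2 (λ x y → (y :- x) :+ x := y) refl (seq x n) (seq y n))
  (ℚ.+-monoˡ-≤ (seq x n) le)) below)

*-monoˡ-≤ : ∀ {a x y} → 0ℝ ≤ a → x ≤ y → a * x ≤ a * y
*-monoˡ-≤ {a} {x} {y} 0≤a x≤y = 0≤y-x⇒x≤y (≤-respʳ (*-nonneg 0≤a (x≤y⇒0≤y-x x≤y))
  (≗⇒≈ λ n → solve 3 (λ a x y → a :* (y :- x) := a :* y :- a :* x) refl (seq a n) (seq x n) (seq y n)))

*-cancelˡ-≈ : ∀ {a x y} → a # 0ℝ → a * x ≈ a * y → x ≈ y
*-cancelˡ-≈ {a} {x} {y} a#0 eq = x-y≈0⇒x≈y (x*y≈0⇒y≈0 a#0 (begin
  a * (x - y)    ≈⟨ ≗⇒≈ (λ n → solve 3 (λ a x y → a :* (x :- y) := a :* x :- a :* y) refl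
                         (seq a n) (seq x n) (seq y n)) ⟩
  a * x - a * y  ≈⟨ +-cong eq ≈-refl ⟩
  a * y - a * y  ≈⟨ -‿inverseʳ (a * y) ⟩
  0ℝ             ∎))
  where open ≈-Reasoning

≤-<-trans : ∀ {x y z} → x ≤ y → y < z → x < z
≤-<-trans {x} {y} {z} x≤y y<z = 0<y-x⇒x<y (<-≤-trans (x<y⇒0<y-x y<z) (0≤y-x⇒x≤y
  (≤-respʳ (x≤y⇒0≤y-x x≤y) (≗⇒≈ λ n → solve 3 (λ x y z → y :- x := (z :- x) :- (z :- y)) refl
    (seq x n) (seq y n) (seq z n)))))

-- Finite sums

sum-mono : ∀ {n} {f g : Fin n → ℝ} → (∀ i → f i ≤ g i) → sum f ≤ sum g
sum-mono {zero}  le = ≤-refl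
sum-mono {suc n} le = +-mono-≤ (le zero) (sum-mono (λ i → le (suc i)))

-- A strict loss in one term could not be made up by the others. This gives both facts about
-- maximisers: a functional is maximal on a sum only if it is so on each summand, and on a convex
-- combination only if it is so wherever the weight is positive.
sum-mono-≈ : ∀ {n} {f g : Fin n → ℝ} → (∀ i → f i ≤ g i) → sum f ≈ sum g → ∀ i → f i ≈ g i
sum-mono-≈ {suc n} {f} {g} le eq = λ { zero → head ; (suc i) → sum-mono-≈ (λ i → le (suc i)) tail i }
  where
  F = sum (λ i → f (suc i))
  G = sum (λ i → g (suc i))
  head : f zero ≈ g zero
  head = ≤-antisym (le zero) (+-cancelʳ-≤ F
    (≤-trans (+-mono-≤ (≤-refl {g zero}) (sum-mono (λ i → le (suc i)))) (≈⇒≤ (≈-sym eq))))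
  tail : F ≈ G
  tail = +-cancelʳ-≈ (g zero) (begin
    F + g zero  ≈⟨ +-comm F (g zero) ⟩
    g zero + F  ≈⟨ +-cong head ≈-refl ⟨
    f zero + F  ≈⟨ eq ⟩
    g zero + G  ≈⟨ +-comm (g zero) G ⟩
    G + g zero  ∎)
    where open ≈-Reasoning

sum-positive : ∀ {n} {f : Fin n → ℝ} → 0ℝ < sum f → ∃ λ i → 0ℝ < f i
sum-positive {zero}  0<0 = contradiction 0<0 (<-irrefl ≈-refl)
sum-positive {suc n} 0<f+ with 0<x+y⇒0<x⊎0<y 0<f+
... | inj₁ 0<f = zero , 0<f
... | inj₂ 0<F with sum-positive 0<F
... | i , 0<fi = suc i , 0<fi

-- The two sums differ by `f i - g i`; the terms are placed crosswise so that no subtraction occurs.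
sum-exchange : ∀ {n} (f g : Fin n → ℝ) i → (∀ j → j ≢ i → f j ≈ g j) → sum f + g i ≈ sum g + f i
sum-exchange f g zero agree = begin
  f zero + F + g zero  ≈⟨ +-cong (+-cong ≈-refl (sum-cong-≋ λ j → agree (suc j) λ ())) ≈-refl ⟩
  f zero + G + g zero  ≈⟨ ≗⇒≈ (λ n → solve 3 (λ a G b → (a :+ G) :+ b := (b :+ G) :+ a) refl
                               (seq (f zero) n) (seq G n) (seq (g zero) n)) ⟩
  g zero + G + f zero  ∎
  where
  open ≈-Reasoning
  F = sum (λ j → f (suc j))
  G = sum (λ j → g (suc j))
sum-exchange f g (suc i) agree = begin
  f zero + F + g (suc i)    ≈⟨ +-assoc (f zero) F (g (suc i)) ⟩
  f zero + (F + g (suc i))  ≈⟨ +-cong (agree zero λ ()) (sum-exchange (λ j → f (suc j)) (λ j → g (suc j)) i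
                                 λ j j≢i → agree (suc j) λ { refl → j≢i refl }) ⟩
  g zero + (G + f (suc i))  ≈⟨ +-assoc (g zero) G (f (suc i)) ⟨
  g zero + G + f (suc i)    ∎
  where
  open ≈-Reasoning
  F = sum (λ j → f (suc j))
  G = sum (λ j → g (suc j))

-- Scalar products

module _ {d : ℕ} where

  ∙-congˡ : ∀ (c : Point d) {x y} → x ≋ y → c ∙ x ≈ c ∙ y
  ∙-congˡ c x≋y = sum-cong-≋ λ j → *-cong ≈-refl (x≋y j)

  ∙-distrib-+ : ∀ (c x y : Point d) → c ∙ (λ j → x j + y j) ≈ c ∙ x + c ∙ y
  ∙-distrib-+ c x y = ≈-trans (sum-cong-≋ λ j → distribˡ (c j) (x j) (y j))
    (∑-distrib-+ (λ j → c j * x j) (λ j → c j * y j))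

  ∙-scale : ∀ (c : Point d) a x → c ∙ (λ j → a * x j) ≈ a * (c ∙ x)
  ∙-scale c a x = ≈-trans
    (sum-cong-≋ λ j → ≗⇒≈ λ n → solve 3 (λ c a x → c :* (a :* x) := a :* (c :* x)) refl
      (seq (c j) n) (seq a n) (seq (x j) n))
    (≈-sym (*-distribˡ-sum a (λ j → c j * x j)))

  ∙-sum : ∀ {n} (c : Point d) (y : Fin n → Point d) → c ∙ (λ j → sum λ i → y i j) ≈ sum λ i → c ∙ y i
  ∙-sum c y = ≈-trans (sum-cong-≋ λ j → *-distribˡ-sum (c j) (λ i → y i j)) (∑-comm λ j i → c j * y i j)

  ∙-combination : ∀ {n} (c : Point d) (w : Fin n → ℝ) (p : Fin n → Point d) →
    c ∙ (λ j → sum λ i → w i * p i j) ≈ sum λ i → w i * (c ∙ p i)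
  ∙-combination c w p = ≈-trans (∙-sum c (λ i j → w i * p i j)) (sum-cong-≋ λ i → ∙-scale c (w i) (p i))

  basis-same : ∀ (j : Fin d) → basis j j ≡ 1ℝ
  basis-same j rewrite dec-true (j ≟ᶠ j) refl = refl

  basis-other : ∀ (j l : Fin d) → j ≢ l → basis j l ≡ 0ℝ
  basis-other j l j≢l rewrite dec-false (j ≟ᶠ l) j≢l = refl

  ∙-basis : ∀ (c : Point d) j → c ∙ basis j ≈ c j
  ∙-basis c j = begin
    c ∙ basis j             ≈⟨ +-identityʳ _ ⟨
    c ∙ basis j + 0ℝ        ≈⟨ sum-exchange (λ l → c l * basis j l) (λ _ → 0ℝ) j
                                 (λ l l≢j → subst (λ z → c l * z ≈ 0ℝ)
                                   (sym (basis-other j l (l≢j ∘ sym))) (zeroʳ (c l))) ⟩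
    sum {d} (λ _ → 0ℝ) + c j * basis j j
                            ≈⟨ +-cong (sum-replicate-zero d) (subst (λ z → c j * z ≈ c j)
                                 (sym (basis-same j)) (*-identityʳ (c j))) ⟩
    0ℝ + c j                ≈⟨ +-identityˡ (c j) ⟩
    c j                     ∎
    where open ≈-Reasoning

  basis-injective : ∀ {j l : Fin d} → basis j ≋ basis l → j ≡ l
  basis-injective {j} {l} eq with l ≟ᶠ j
  ... | yes l≡j = sym l≡j
  ... | no  l≢j = contradiction 0<1
    (<-irrefl (≈-sym (subst₂ _≈_ (basis-same j) (basis-other l j l≢j) (eq j))))

-- Exposed points

-- The condition inside `IsVertex`, with the functional as a parameter so that one `c` can be
-- followed from a Minkowski sum to its summands and back.
Exposes : ∀ {d} → Point d → Pred (Point d) 0ℓ → Point d → Set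
Exposes c P v = ∀ x → x ∈ P → c ∙ x ≤ c ∙ v × (c ∙ x ≈ c ∙ v → x ≋ v)

weighted-constant : ∀ {n} (w : Fin n → ℝ) a → sum w ≈ 1ℝ → (sum λ t → w t * a) ≈ a
weighted-constant w a ∑w≈1 =
  ≈-trans (≈-sym (*-distribʳ-sum a w)) (≈-trans (*-cong ∑w≈1 ≈-refl) (*-identityˡ a))

∈⇒∈conv : ∀ {d} {S : Pred (Point d) 0ℓ} {p} → p ∈ S → p ∈ conv S
∈⇒∈conv {p = p} p∈S = 1 , (λ _ → p) , (λ _ → 1ℝ) , (λ _ → p∈S) , (λ _ → <⇒≤ 0<1) , +-identityʳ 1ℝ ,
  λ j → ≈-sym (≈-trans (+-identityʳ _) (*-identityˡ (p j)))

module _ {d : ℕ} {c : Point d} where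

  -- Replacing the summand y i by another point of A i stays in the Minkowski sum.
  exposes-summand : ∀ {n} {A : Fin n → Pred (Point d) 0ℓ} {v} → Exposes c (minkowskiSum A) v →
    (y : Fin n → Point d) → (∀ i → y i ∈ A i) → v ≋ (λ j → sum λ i → y i j) →
    ∀ i → Exposes c (A i) (y i)
  exposes-summand {n} {A} {v} exposed y y∈A v≋ i p p∈A = c∙p≤c∙y , p≋y
    where
    open ≈-Reasoning
    z : Fin n → Point d
    z = updateAt y i (const p)

    z∈A : ∀ l → z l ∈ A l
    z∈A l with l ≟ᶠ i
    ... | yes refl = subst (A i) (sym (updateAt-updates i y)) p∈A
    ... | no  l≢i  = subst (A l) (sym (updateAt-minimal l i y l≢i)) (y∈A l)

    x : Point d
    x j = sum λ l → z l j

    exchange : ∀ j → x j + y i j ≈ v j + p j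
    exchange j = begin
      x j + y i j                       ≈⟨ sum-exchange (λ l → z l j) (λ l → y l j) i
                                             (λ l l≢i → subst (λ q → q j ≈ y l j)
                                               (sym (updateAt-minimal l i y l≢i)) ≈-refl) ⟩
      (sum λ l → y l j) + z i j         ≈⟨ +-cong (≈-sym (v≋ j)) (subst (λ q → q j ≈ p j)
                                             (sym (updateAt-updates i y)) ≈-refl) ⟩
      v j + p j                         ∎

    c-exchange : c ∙ x + c ∙ y i ≈ c ∙ v + c ∙ p
    c-exchange = begin
      c ∙ x + c ∙ y i               ≈⟨ ∙-distrib-+ c x (y i) ⟨
      c ∙ (λ j → x j + y i j)       ≈⟨ ∙-congˡ c exchange ⟩
      c ∙ (λ j → v j + p j)         ≈⟨ ∙-distrib-+ c v p ⟩
      c ∙ v + c ∙ p                 ∎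

    maximal = exposed x (z , z∈A , λ _ → ≈-refl)

    c∙p≤c∙y : c ∙ p ≤ c ∙ y i
    c∙p≤c∙y = +-cancelʳ-≤ (c ∙ v) (≤-respˡ (≈-trans (+-comm _ _) (≈-sym c-exchange))
      (≤-respʳ (+-mono-≤ (proj₁ maximal) ≤-refl) (+-comm _ _)))

    p≋y : c ∙ p ≈ c ∙ y i → p ≋ y i
    p≋y eq j = +-cancelʳ-≈ (v j) (begin
      p j + v j    ≈⟨ +-comm _ _ ⟩
      v j + p j    ≈⟨ exchange j ⟨
      x j + y i j  ≈⟨ +-cong (proj₂ maximal (+-cancelʳ-≈ (c ∙ y i) (≈-trans c-exchange (+-cong ≈-refl eq))) j)
                        ≈-refl ⟩
      v j + y i j  ≈⟨ +-comm _ _ ⟩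
      y i j + v j  ∎)

  exposes-sum : ∀ {n} {A : Fin n → Pred (Point d) 0ℓ} (y : Fin n → Point d) →
    (∀ i → Exposes c (A i) (y i)) → Exposes c (minkowskiSum A) (λ j → sum λ i → y i j)
  exposes-sum y exposed x (y′ , y′∈A , x≋) =
    ≤-respˡ c∙x (≤-respʳ (sum-mono le) (≈-sym (∙-sum c y))) ,
    λ eq j → ≈-trans (x≋ j) (sum-cong-≋ λ i →
      proj₂ (exposed i (y′ i) (y′∈A i))
        (sum-mono-≈ le (≈-trans (≈-sym c∙x) (≈-trans eq (∙-sum c y))) i) j)
    where
    c∙x : c ∙ x ≈ sum λ i → c ∙ y′ i
    c∙x = ≈-trans (∙-congˡ c x≋) (∙-sum c y′)
    le : ∀ i → c ∙ y′ i ≤ c ∙ y i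
    le i = proj₁ (exposed i (y′ i) (y′∈A i))

  -- A point carrying positive weight in a convex combination attains the maximum.
  exposed-generator : ∀ {S : Pred (Point d) 0ℓ} {v} → Exposes c (conv S) v → v ∈ conv S →
    ∃ λ p → p ∈ S × v ≋ p
  exposed-generator {S} {v} exposed (n , p , w , p∈S , 0≤w , ∑w≈1 , v≋)
    with sum-positive (<-≤-trans 0<1 (≈⇒≤ (≈-sym ∑w≈1)))
  ... | t , 0<wt = p t , p∈S t , λ j → ≈-sym (proj₂ (maximal t) c∙p≈c∙v j)
    where
    maximal = λ t → exposed (p t) (∈⇒∈conv {S = S} (p∈S t))

    weighted : ∀ t → w t * (c ∙ p t) ≈ w t * (c ∙ v)
    weighted = sum-mono-≈ (λ t → *-monoˡ-≤ (0≤w t) (proj₁ (maximal t)))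
      (≈-trans (≈-sym (≈-trans (∙-congˡ c v≋) (∙-combination c w p))) (≈-sym (weighted-constant w (c ∙ v) ∑w≈1)))

    c∙p≈c∙v : c ∙ p t ≈ c ∙ v
    c∙p≈c∙v = *-cancelˡ-≈ (inj₂ 0<wt) (weighted t)

  -- A generator strictly below the maximum must have weight 0 in a maximising combination, and all
  -- others equal `v`. The hypothesis is a disjunction because the two cases could not be told apart
  -- from the reals alone.
  exposes-conv : ∀ {S : Pred (Point d) 0ℓ} {v} → (∀ p → p ∈ S → p ≋ v ⊎ c ∙ p < c ∙ v) →
    Exposes c (conv S) v
  exposes-conv {v = v} max x (n , p , w , p∈S , 0≤w , ∑w≈1 , x≋) =
    ≤-respˡ c∙x (≤-respʳ (sum-mono le) (weighted-constant w (c ∙ v) ∑w≈1)) ,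
    λ eq j → ≈-trans (x≋ j) (≈-trans
      (sum-cong-≋ λ t → equal t (sum-mono-≈ le
        (≈-trans (≈-sym c∙x) (≈-trans eq (≈-sym (weighted-constant w (c ∙ v) ∑w≈1)))) t) j)
      (weighted-constant w (v j) ∑w≈1))
    where
    c∙x : c ∙ x ≈ sum λ t → w t * (c ∙ p t)
    c∙x = ≈-trans (∙-congˡ c x≋) (∙-combination c w p)

    c∙p≤c∙v : ∀ t → c ∙ p t ≤ c ∙ v
    c∙p≤c∙v t with max (p t) (p∈S t)
    ... | inj₁ p≋v = ≈⇒≤ (∙-congˡ c p≋v)
    ... | inj₂ lt  = <⇒≤ lt

    le : ∀ t → w t * (c ∙ p t) ≤ w t * (c ∙ v)
    le t = *-monoˡ-≤ (0≤w t) (c∙p≤c∙v t)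

    equal : ∀ t → w t * (c ∙ p t) ≈ w t * (c ∙ v) → ∀ j → w t * p t j ≈ w t * v j
    equal t eq j with max (p t) (p∈S t)
    ... | inj₁ p≋v = *-cong ≈-refl (p≋v j)
    ... | inj₂ lt  = ≈-trans (*-cong wt≈0 ≈-refl) (≈-trans (zeroˡ _)
                       (≈-sym (≈-trans (*-cong wt≈0 ≈-refl) (zeroˡ _))))
      where
      wt≈0 : w t ≈ 0ℝ
      wt≈0 = x*y≈0⇒y≈0 (inj₂ (x<y⇒0<y-x lt)) (begin
        (c ∙ v - c ∙ p t) * w t            ≈⟨ ≗⇒≈ (λ n → solve 3 (λ m p w → (m :- p) :* w := w :* m :- w :* p) refl
                                                (seq (c ∙ v) n) (seq (c ∙ p t) n) (seq (w t) n)) ⟩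
        w t * (c ∙ v) - w t * (c ∙ p t)        ≈⟨ +-cong (≈-sym eq) ≈-refl ⟩
        w t * (c ∙ p t) - w t * (c ∙ p t)      ≈⟨ -‿inverseʳ _ ⟩
        0ℝ                                 ∎)
        where open ≈-Reasoning

  abstract

    exposed-basis : ∀ {I : Pred (Fin d) 0ℓ} {v} → Exposes c (simplex I) v → v ∈ simplex I →
      ∃ λ j → j ∈ I × v ≋ basis j
    exposed-basis {I} {v} exposed v∈ =
      let p , (j , j∈I , p≋) , v≋p = exposed-generator {S = λ x → ∃ λ j → j ∈ I × x ≋ basis j} {v} exposed v∈
      in j , j∈I , λ l → ≈-trans (v≋p l) (p≋ l)

  exposed-basis-maximal : ∀ {I : Pred (Fin d) 0ℓ} {v j} → Exposes c (simplex I) v → v ≋ basis j →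
    ∀ l → l ∈ I → c l ≤ c j × (c l ≈ c j → l ≡ j)
  exposed-basis-maximal {I} {v} {j} exposed v≋ l l∈I =
    ≤-respˡ (≈-sym (∙-basis c l)) (≤-respʳ (proj₁ maximal) c∙v) ,
    λ eq → basis-injective λ i → ≈-trans (proj₂ maximal (≈-trans (∙-basis c l) (≈-trans eq (≈-sym c∙v))) i) (v≋ i)
    where
    maximal = exposed (basis l) (∈⇒∈conv {S = λ x → ∃ λ j → j ∈ I × x ≋ basis j} {basis l} (l , l∈I , λ _ → ≈-refl))
    c∙v : c ∙ v ≈ c j
    c∙v = ≈-trans (∙-congˡ c v≋) (∙-basis c j)

  exposes-basis : ∀ {I : Pred (Fin d) 0ℓ} {j} → (∀ l → l ∈ I → l ≢ j → c l < c j) →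
    Exposes c (simplex I) (basis j)
  exposes-basis {I} {j} max = exposes-conv {S = λ x → ∃ λ l → l ∈ I × x ≋ basis l} {basis j} generator
    where
    generator : ∀ p → (∃ λ l → l ∈ I × p ≋ basis l) → p ≋ basis j ⊎ c ∙ p < c ∙ basis j
    generator p (l , l∈I , p≋) with l ≟ᶠ j
    ... | yes refl = inj₁ p≋
    ... | no  l≢j  = inj₂ (≤-<-trans (≈⇒≤ (≈-trans (∙-congˡ c p≋) (∙-basis c l)))
                       (<-≤-trans (max l l∈I l≢j) (≈⇒≤ (≈-sym (∙-basis c j)))))

  -- Both `y i` and `z i` maximise `c` over `A i`, so `c` has the same value on them, and the
  -- maximiser is unique. Through this a vertex determines its admissible sequence.
  exposed-summands-unique : ∀ {n} {A : Fin n → Pred (Point d) 0ℓ} {v} → Exposes c (minkowskiSum A) v →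
    (y z : Fin n → Point d) → (∀ i → y i ∈ A i) → (∀ i → z i ∈ A i) →
    v ≋ (λ j → sum λ i → y i j) → v ≋ (λ j → sum λ i → z i j) → ∀ i → y i ≋ z i
  exposed-summands-unique {A = A} {v} exposed y z y∈A z∈A v≋y v≋z i =
    proj₂ (exposes-z (y i) (y∈A i))
      (≤-antisym (proj₁ (exposes-z (y i) (y∈A i))) (proj₁ (exposes-y (z i) (z∈A i))))
    where
    exposes-y = exposes-summand {A = A} {v} exposed y y∈A v≋y i
    exposes-z = exposes-summand {A = A} {v} exposed z z∈A v≋z i

-- The embedding of the integers into the rationals and the reals

toℚᵘ-/1 : ∀ z → ℚ.toℚᵘ (z ℚ./ 1) ℚᵘ.≃ ℚᵘ.mkℚᵘ z 0
toℚᵘ-/1 z = ℚ.toℚᵘ-fromℚᵘ (ℚᵘ.mkℚᵘ z 0)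

/1-homo-+ : ∀ a b → (a ℤ.+ b) ℚ./ 1 ≡ a ℚ./ 1 ℚ.+ b ℚ./ 1
/1-homo-+ a b = ℚ.toℚᵘ-injective (begin
  ℚ.toℚᵘ ((a ℤ.+ b) ℚ./ 1)                  ≈⟨ toℚᵘ-/1 (a ℤ.+ b) ⟩
  ℚᵘ.mkℚᵘ (a ℤ.+ b) 0
    ≈⟨ ℚᵘ.*≡* (cong (ℤ._* + 1) (sym (cong₂ ℤ._+_ (ℤ.*-identityʳ a) (ℤ.*-identityʳ b)))) ⟩
  ℚᵘ.mkℚᵘ a 0 ℚᵘ.+ ℚᵘ.mkℚᵘ b 0              ≈⟨ ℚᵘ.+-cong (toℚᵘ-/1 a) (toℚᵘ-/1 b) ⟨
  ℚ.toℚᵘ (a ℚ./ 1) ℚᵘ.+ ℚ.toℚᵘ (b ℚ./ 1)    ≈⟨ ℚ.toℚᵘ-homo-+ (a ℚ./ 1) (b ℚ./ 1) ⟨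
  ℚ.toℚᵘ (a ℚ./ 1 ℚ.+ b ℚ./ 1)              ∎)
  where open import Relation.Binary.Reasoning.Setoid ℚᵘ.≃-setoid

/1-homo-* : ∀ a b → (a ℤ.* b) ℚ./ 1 ≡ (a ℚ./ 1) ℚ.* (b ℚ./ 1)
/1-homo-* a b = ℚ.toℚᵘ-injective (begin
  ℚ.toℚᵘ ((a ℤ.* b) ℚ./ 1)                  ≈⟨ toℚᵘ-/1 (a ℤ.* b) ⟩
  ℚᵘ.mkℚᵘ a 0 ℚᵘ.* ℚᵘ.mkℚᵘ b 0              ≈⟨ ℚᵘ.*-cong (toℚᵘ-/1 a) (toℚᵘ-/1 b) ⟨
  ℚ.toℚᵘ (a ℚ./ 1) ℚᵘ.* ℚ.toℚᵘ (b ℚ./ 1)    ≈⟨ ℚ.toℚᵘ-homo-* (a ℚ./ 1) (b ℚ./ 1) ⟨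
  ℚ.toℚᵘ ((a ℚ./ 1) ℚ.* (b ℚ./ 1))              ∎)
  where open import Relation.Binary.Reasoning.Setoid ℚᵘ.≃-setoid

/1-mono-≤ : ∀ {a b} → a ℤ.≤ b → a ℚ./ 1 ℚ.≤ b ℚ./ 1
/1-mono-≤ {a} {b} a≤b = ℚ.toℚᵘ-cancel-≤ (ℚᵘ.≤-trans (ℚᵘ.≤-reflexive (toℚᵘ-/1 a))
  (ℚᵘ.≤-trans (ℚᵘ.*≤* (ℤ.*-monoʳ-≤-nonNeg (+ 1) a≤b)) (ℚᵘ.≤-reflexive (ℚᵘ.≃-sym (toℚᵘ-/1 b)))))

fromℤ-mono-< : ∀ {a b} → a ℕ.< b → fromℤ (+ a) < fromℤ (+ b)
fromℤ-mono-< {a} {b} a<b = mk< 1ℚ (ℚ.positive⁻¹ 1ℚ) (0 , λ _ _ →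
  subst (ℚ._≤ + b ℚ./ 1) (trans (cong (λ n → + n ℚ./ 1) (ℕ.+-comm 1 a)) (/1-homo-+ (+ a) (+ 1)))
    (/1-mono-≤ (ℤ.+≤+ a<b)))

-- Vertices of the polytope and admissible sequences

module Vertices (s m : ℕ) (m≤s : m ℕ.≤ s) (l : ℕ) where

  open Offsets s m m≤s

  n d : ℕ
  n = suc l
  d = ambientDim n k s

  Λ : Fin n → Pred (Fin d) 0ℓ
  Λ i = interval k s (toℕ i)

  Summand : Fin n → Pred (Point d) 0ℓ
  Summand i = simplex (Λ i)

  private variable
    os os′ : Vec ℕ n

  position<d : ∀ (i : Fin n) {o} → o ℕ.< k → s ℕ.* toℕ i ℕ.+ o ℕ.< d
  position<d i = ℕ.+-mono-≤-< (ℕ.*-monoʳ-≤ s (toℕ≤pred[n] i))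

  abstract

    place : Admissible os → Fin n → Fin d
    place adm i = fromℕ< (position<d i (bounded adm i))

    toℕ-place : (adm : Admissible os) → ∀ i → toℕ (place adm i) ≡ s ℕ.* toℕ i ℕ.+ lookup os i
    toℕ-place adm i = toℕ-fromℕ< (position<d i (bounded adm i))

  place∈Λ : (adm : Admissible os) → ∀ i → place adm i ∈ Λ i
  place∈Λ {os} adm i rewrite toℕ-place adm i = ℕ.m≤m+n _ _ , ℕ.+-monoʳ-< (s ℕ.* toℕ i) (bounded adm i)

  point : Admissible os → Point d
  point adm j = sum λ i → basis (place adm i) j

  basis∈Summand : ∀ i {j} → j ∈ Λ i → basis j ∈ Summand i
  basis∈Summand i {j} j∈ = ∈⇒∈conv {S = λ x → ∃ λ j → j ∈ Λ i × x ≋ basis j} (j , j∈ , λ _ → ≈-refl)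

  point-isVertex : (adm : Admissible os) → IsVertex (polytope n k s) (point adm)
  point-isVertex {os} adm =
    ((λ i → basis (place adm i)) , (λ i → basis∈Summand i (place∈Λ adm i)) , λ _ → ≈-refl) ,
    functional ,
    exposes-sum {c = functional} {A = Summand} (λ i → basis (place adm i)) λ i → exposes-basis (maximal i)
    where
    functional : Point d
    functional j = fromℤ (+ height os (toℕ j))

    maximal : ∀ i j → j ∈ Λ i → j ≢ place adm i → functional j < functional (place adm i)
    maximal i j (lo , hi) j≢ =
      let q , eq = ℕ.m≤n⇒∃[o]m+o≡n lo in
      fromℤ-mono-< (subst₂ (λ a b → height os a ℕ.< height os b) eq (sym (toℕ-place adm i))
        (height-maximal adm i q (ℕ.+-cancelˡ-< _ q k (subst (ℕ._< s ℕ.* toℕ i ℕ.+ k) (sym eq) hi))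
          λ q≡o → j≢ (toℕ-injective (trans (sym eq)
            (trans (cong (s ℕ.* toℕ i ℕ.+_) q≡o) (sym (toℕ-place adm i)))))))

  point-cong : (adm : Admissible os) (adm′ : Admissible os′) → os ≡ os′ → point adm ≋ point adm′
  point-cong adm adm′ refl j = sum-cong-≋ λ i → ≈-reflexive (cong (λ p → basis p j)
    (toℕ-injective (trans (toℕ-place adm i) (sym (toℕ-place adm′ i)))))

  point-injective : (adm : Admissible os) (adm′ : Admissible os′) → point adm ≋ point adm′ → os ≡ os′
  point-injective {os} {os′} adm adm′ eq = lookup-extensional λ i →
    ℕ.+-cancelˡ-≡ (s ℕ.* toℕ i) _ _ (trans (sym (toℕ-place adm i))
      (trans (cong toℕ (basis-injective (bases i))) (toℕ-place adm′ i)))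
    where
    bases : ∀ i → basis (place adm i) ≋ basis (place adm′ i)
    bases = let _ , c , exposed = point-isVertex adm in
      exposed-summands-unique {c = c} {A = Summand} {point adm} exposed
        (λ i → basis (place adm i)) (λ i → basis (place adm′ i))
        (λ i → basis∈Summand i (place∈Λ adm i)) (λ i → basis∈Summand i (place∈Λ adm′ i))
        (λ _ → ≈-refl) eq

  abstract

    vertex-point : ∀ {v} → IsVertex (polytope n k s) v →
      Σ[ os ∈ Vec ℕ n ] Σ[ adm ∈ Admissible os ] v ≋ point adm
    vertex-point {v} ((y , y∈ , v≋) , c , exposed) = offsets , adm , λ j′ → ≈-trans (v≋ j′)
      (sum-cong-≋ λ i → ≈-trans (y≋ i j′) (≈-reflexive (cong (λ p → basis p j′) (sym (place≡j i)))))
      where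
      exposes-y : ∀ i → Exposes c (Summand i) (y i)
      exposes-y = exposes-summand {c = c} {A = Summand} {v} exposed y y∈ v≋

      attained : ∀ i → ∃ λ j → j ∈ Λ i × y i ≋ basis j
      attained i = exposed-basis {I = Λ i} (exposes-y i) (y∈ i)

      j : Fin n → Fin d
      j i = proj₁ (attained i)

      j∈Λ : ∀ i → j i ∈ Λ i
      j∈Λ i = proj₁ (proj₂ (attained i))

      y≋ : ∀ i → y i ≋ basis (j i)
      y≋ i = proj₂ (proj₂ (attained i))

      offset : Fin n → ℕ
      offset i = toℕ (j i) ℕ.∸ s ℕ.* toℕ i

      offsets : Vec ℕ n
      offsets = tabulate offset

      toℕ-j : ∀ i → toℕ (j i) ≡ s ℕ.* toℕ i ℕ.+ lookup offsets i
      toℕ-j i = sym (trans (cong (s ℕ.* toℕ i ℕ.+_) (lookup∘tabulate offset i)) (ℕ.m+[n∸m]≡n (proj₁ (j∈Λ i))))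

      -- If both choices lie in the overlap, then each is at least as high as the other.
      compatible : ∀ (i : Fin l) → s ℕ.≤ lookup offsets (inject₁ i) → lookup offsets (suc i) ℕ.< m →
                   lookup offsets (inject₁ i) ≡ s ℕ.+ lookup offsets (suc i)
      compatible i s≤o₁ o₂<m = ℕ.+-cancelˡ-≡ (s ℕ.* toℕ i) _ _
        (trans (sym toℕ-j₁) (trans (cong toℕ j₁≡j₂) toℕ-j₂))
        where
        o₁ o₂ : ℕ
        o₁ = lookup offsets (inject₁ i)
        o₂ = lookup offsets (suc i)
        j₁ j₂ : Fin d
        j₁ = j (inject₁ i)
        j₂ = j (suc i)

        toℕ-j₁ : toℕ j₁ ≡ s ℕ.* toℕ i ℕ.+ o₁
        toℕ-j₁ = trans (toℕ-j (inject₁ i)) (cong (λ a → s ℕ.* a ℕ.+ o₁) (toℕ-inject₁ i))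

        s*suc : ∀ a → s ℕ.* suc (toℕ i) ℕ.+ a ≡ s ℕ.* toℕ i ℕ.+ (s ℕ.+ a)
        s*suc a = trans (cong (ℕ._+ a) (trans (ℕ.*-suc s (toℕ i)) (ℕ.+-comm s (s ℕ.* toℕ i))))
          (ℕ.+-assoc (s ℕ.* toℕ i) s a)

        toℕ-j₂ : toℕ j₂ ≡ s ℕ.* toℕ i ℕ.+ (s ℕ.+ o₂)
        toℕ-j₂ = trans (toℕ-j (suc i)) (s*suc o₂)

        j₁∈Λ : j₁ ∈ Λ (suc i)
        j₁∈Λ =
          ℕ.≤-trans (subst (ℕ._≤ s ℕ.* toℕ i ℕ.+ o₁) (trans (ℕ.+-comm (s ℕ.* toℕ i) s) (sym (ℕ.*-suc s (toℕ i))))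
            (ℕ.+-monoʳ-≤ (s ℕ.* toℕ i) s≤o₁)) (ℕ.≤-reflexive (sym toℕ-j₁)) ,
          ℕ.<-≤-trans (subst (λ a → toℕ j₁ ℕ.< s ℕ.* a ℕ.+ k) (toℕ-inject₁ i) (proj₂ (j∈Λ (inject₁ i))))
            (ℕ.+-monoˡ-≤ k (ℕ.*-monoʳ-≤ s (ℕ.n≤1+n (toℕ i))))

        j₂∈Λ : j₂ ∈ Λ (inject₁ i)
        j₂∈Λ = subst (λ a → s ℕ.* a ℕ.≤ toℕ j₂ × toℕ j₂ ℕ.< s ℕ.* a ℕ.+ k) (sym (toℕ-inject₁ i))
          ( ℕ.≤-trans (ℕ.*-monoʳ-≤ s (ℕ.n≤1+n (toℕ i))) (proj₁ (j∈Λ (suc i)))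
          , subst (ℕ._< s ℕ.* toℕ i ℕ.+ k) (sym toℕ-j₂) (ℕ.+-monoʳ-< (s ℕ.* toℕ i) (ℕ.+-monoʳ-< s o₂<m)) )

        max₁ : c j₂ ≤ c j₁ × (c j₂ ≈ c j₁ → j₂ ≡ j₁)
        max₁ = exposed-basis-maximal {I = Λ (inject₁ i)} (exposes-y (inject₁ i)) (y≋ (inject₁ i)) j₂ j₂∈Λ
        max₂ : c j₁ ≤ c j₂ × (c j₁ ≈ c j₂ → j₁ ≡ j₂)
        max₂ = exposed-basis-maximal {I = Λ (suc i)} (exposes-y (suc i)) (y≋ (suc i)) j₁ j₁∈Λ

        j₁≡j₂ : j₁ ≡ j₂
        j₁≡j₂ = proj₂ max₂ (≤-antisym (proj₁ max₂) (proj₁ max₁))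

      adm : Admissible offsets
      adm = admissible offsets
        (λ i → ℕ.+-cancelˡ-< (s ℕ.* toℕ i) _ k
          (subst (ℕ._< s ℕ.* toℕ i ℕ.+ k) (toℕ-j i) (proj₂ (j∈Λ i))))
        compatible

      place≡j : ∀ i → place adm i ≡ j i
      place≡j i = toℕ-injective (trans (toℕ-place adm i) (sym (toℕ-j i)))

  hasVertexCount : HasVertexCount (polytope n k s) (count n)
  hasVertexCount = record
    { to        = λ i → point (nth-admissible i) , point-isVertex (nth-admissible i)
    ; from      = index
    ; to-cong   = λ { refl _ → ≈-refl }
    ; from-cong = λ {v} {w} v≋w → index-cong v w v≋w
    ; inverse   = (λ { {v} refl j → ≈-sym (point-index v j) })
                , λ {i} {v} v≋ → lookup-injective (sequences-unique n) _ _ (sym (point-injective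
                    (nth-admissible i) (nth-admissible (index v)) λ j → ≈-trans (≈-sym (v≋ j)) (point-index v j)))
    }
    where
    Vertex = ∃ (IsVertex (polytope n k s))

    nth : Fin (count n) → Vec ℕ n
    nth = List.lookup (sequences n)

    nth-admissible : ∀ i → Admissible (nth i)
    nth-admissible i = sequences-sound n (∈-lookup i)

    index : Vertex → Fin (count n)
    index (_ , vertex) = let _ , adm , _ = vertex-point vertex in Any.index (sequences-complete adm)

    point-index : ∀ ((v , vertex) : Vertex) → v ≋ point (nth-admissible (index (v , vertex)))
    point-index (v , vertex) j = let os , adm , v≋ = vertex-point vertex in
      ≈-trans (v≋ j) (point-cong adm (nth-admissible (index (v , vertex)))
        (lookup-index (sequences-complete adm)) j)

    -- Equal points may come with different functionals and summands. Each agrees with the point of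
    -- its own admissible sequence, and such a point determines the sequence.
    index-cong : ∀ (V W : Vertex) → proj₁ V ≋ proj₁ W → index V ≡ index W
    index-cong V W v≋w = lookup-injective (sequences-unique n) _ _
      (point-injective (nth-admissible (index V)) (nth-admissible (index W))
        λ j → ≈-trans (≈-sym (point-index V j)) (≈-trans (v≋w j) (point-index W j)))

-- Square roots of positive integers

isqrt : ∀ x → ∃ λ a → a ℕ.* a ℕ.≤ x × x ℕ.< suc a ℕ.* suc a
isqrt zero    = 0 , ℕ.z≤n , ℕ.s≤s ℕ.z≤n
isqrt (suc x) with isqrt x
... | a , lo , hi with suc a ℕ.* suc a ℕ.≤? suc x
... | yes le = suc a , le , ℕ.≤-<-trans hi (ℕ.*-mono-< (ℕ.n<1+n (suc a)) (ℕ.n<1+n (suc a)))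
... | no  ≰  = a , ℕ.m≤n⇒m≤1+n lo , ℕ.≰⇒> ≰

fromℕ : ℕ → ℚ
fromℕ n = + n ℚ./ 1

fromℕ-homo-* : ∀ a b → fromℕ (a ℕ.* b) ≡ fromℕ a ℚ.* fromℕ b
fromℕ-homo-* a b = trans (cong (ℚ._/ 1) (ℤ.pos-* a b)) (/1-homo-* (+ a) (+ b))

fromℕ-mono-≤ : ∀ a b → a ℕ.≤ b → fromℕ a ℚ.≤ fromℕ b
fromℕ-mono-≤ a b a≤b = /1-mono-≤ (ℤ.+≤+ a≤b)

fromℕ-mono-< : ∀ a b → a ℕ.< b → fromℕ a ℚ.< fromℕ b
fromℕ-mono-< a b a<b = ℚ.<-≤-trans
  (subst₂ ℚ._<_ (ℚ.+-identityʳ (fromℕ a)) (sym (trans (cong fromℕ (ℕ.+-comm 1 a)) (/1-homo-+ (+ a) (+ 1))))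
    (ℚ.+-monoʳ-< (fromℕ a) (ℚ.positive⁻¹ 1ℚ)))
  (fromℕ-mono-≤ (suc a) b a<b)

p²<q²⇒p≤q : ∀ p q → 0ℚ ℚ.≤ q → p ℚ.* p ℚ.< q ℚ.* q → p ℚ.≤ q
p²<q²⇒p≤q p q 0≤q lt with ℚ.≤-total p q
... | inj₁ p≤q = p≤q
... | inj₂ q≤p = contradiction (ℚ.<-≤-trans lt (*-mono-≤ q p q p 0≤q (ℚ.≤-trans 0≤q q≤p) q≤p q≤p)) (ℚ.<-irrefl refl)

unit : ℕ → ℚ
unit n = recip (fromℕ (suc n))

abstract

  unit>0 : ∀ n → 0ℚ ℚ.< unit n
  unit>0 n = recip>0 (fromℕ (suc n)) (fromℕ-mono-< 0 (suc n) (ℕ.s≤s ℕ.z≤n))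

  fromℕ*unit : ∀ n → fromℕ (suc n) ℚ.* unit n ≡ 1ℚ
  fromℕ*unit n = recip-inverseʳ (fromℕ (suc n)) λ eq →
    ℚ.<-irrefl (sym eq) (fromℕ-mono-< 0 (suc n) (ℕ.s≤s ℕ.z≤n))

  -- The numerator of a positive rational is at least 1. The denominator of ε thus serves as the
  -- index beyond which `unit` stays below ε.
  1≤denominator*ε : ∀ ε → 0ℚ ℚ.< ε → 1ℚ ℚ.≤ fromℕ (ℚ.↧ₙ ε) ℚ.* ε
  1≤denominator*ε ε@(ℚ.mkℚ (+ zero) _ _) 0<ε = contradiction 0<ε λ { (ℚ.*<* (ℤ.+<+ ())) }
  1≤denominator*ε ε@(ℚ.mkℚ (ℤ.-[1+ _ ]) _ _) 0<ε = contradiction 0<ε λ { (ℚ.*<* ()) }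
  1≤denominator*ε ε@(ℚ.mkℚ (+ suc a) b-1 _) 0<ε = ℚ.toℚᵘ-cancel-≤ (ℚᵘ.≤-respʳ-≃
    (ℚᵘ.≃-sym (ℚᵘ.≃-trans (ℚ.toℚᵘ-homo-* (fromℕ (suc b-1)) ε) (ℚᵘ.*-congʳ {ℚ.toℚᵘ ε} (toℚᵘ-/1 (+ suc b-1)))))
    (ℚᵘ.*≤* (ℤ.+≤+ lemma)))
    where
    lemma : 1 ℕ.* suc (b-1 ℕ.+ 0) ℕ.≤ suc b-1 ℕ.* suc a ℕ.* 1
    lemma = begin
      1 ℕ.* suc (b-1 ℕ.+ 0)      ≡⟨ cong suc (trans (ℕ.+-identityʳ _) (ℕ.+-identityʳ b-1)) ⟩
      suc b-1                    ≤⟨ ℕ.m≤m*n (suc b-1) (suc a) ⟩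
      suc b-1 ℕ.* suc a          ≡⟨ ℕ.*-identityʳ _ ⟨
      suc b-1 ℕ.* suc a ℕ.* 1    ∎
      where open ℕ.≤-Reasoning

  unit-small : ∀ ε → 0ℚ ℚ.< ε → Eventually λ n → unit n ℚ.≤ ε
  unit-small ε 0<ε = ℚ.↧ₙ ε , λ n le → begin
    unit n                                      ≡⟨ ℚ.*-identityʳ (unit n) ⟨
    unit n ℚ.* 1ℚ                               ≤⟨ ℚ.*-monoˡ-≤-nonNeg (unit n) {{ℚ.nonNegative (ℚ.<⇒≤ (unit>0 n))}}
                                                     (ℚ.≤-trans (1≤denominator*ε ε 0<ε)
                                                       (ℚ.*-monoʳ-≤-nonNeg ε {{ℚ.nonNegative (ℚ.<⇒≤ 0<ε)}}
                                                         (fromℕ-mono-≤ (ℚ.↧ₙ ε) (suc n) (ℕ.m≤n⇒m≤1+n le)))) ⟩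
    unit n ℚ.* (fromℕ (suc n) ℚ.* ε)            ≡⟨ solve 3 (λ u N ε → u :* (N :* ε) := (N :* u) :* ε) refl
                                                     (unit n) (fromℕ (suc n)) ε ⟩
    fromℕ (suc n) ℚ.* unit n ℚ.* ε              ≡⟨ cong (ℚ._* ε) (fromℕ*unit n) ⟩
    1ℚ ℚ.* ε                                    ≡⟨ ℚ.*-identityˡ ε ⟩
    ε                                           ∎
    where open ℚ.≤-Reasoning

  cauchy-from-bound : ∀ x → (∀ m n → x m ℚ.≤ x n ℚ.+ unit n) → Cauchy x
  cauchy-from-bound x bound ε 0<ε = let N , f = unit-small ε 0<ε in N , λ m n lm ln →
    ∣p∣≤q _ ε
      (p≤q+r⇒p-q≤r (x m) (x n) ε (ℚ.≤-trans (bound m n) (ℚ.+-monoʳ-≤ (x n) (f n ln))))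
      (subst (ℚ._≤ ε) (solve 2 (λ a b → b :- a := :- (a :- b)) refl (x m) (x n))
        (p≤q+r⇒p-q≤r (x n) (x m) ε (ℚ.≤-trans (bound n m) (ℚ.+-monoʳ-≤ (x m) (f m lm)))))

  unit-cauchy : Cauchy unit
  unit-cauchy ε 0<ε = let N , f = unit-small ε 0<ε in N , λ m n lm ln →
    ∣p∣≤q _ ε
      (ℚ.≤-trans (ℚ.≤-trans (ℚ.+-monoʳ-≤ (unit m) (ℚ.neg-antimono-≤ (ℚ.<⇒≤ (unit>0 n))))
        (ℚ.≤-reflexive (ℚ.+-identityʳ (unit m)))) (f m lm))
      (ℚ.≤-trans (ℚ.≤-reflexive (solve 2 (λ a b → :- (a :- b) := b :- a) refl (unit m) (unit n)))
        (ℚ.≤-trans (ℚ.+-monoʳ-≤ (unit n) (ℚ.neg-antimono-≤ (ℚ.<⇒≤ (unit>0 m))))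
          (ℚ.≤-trans (ℚ.≤-reflexive (ℚ.+-identityʳ (unit n))) (f n ln))))

-- The sequence 1/(n+1), a representative of 0. The inequality `√ * √ ≤ D` holds termwise, but the
-- opposite one does so only after `unit n` is added to the n-th term; adding this real changes
-- nothing up to `_≈_`.
infinitesimal : ℝ
infinitesimal .seq    = unit
infinitesimal .cauchy = unit-cauchy

abstract

  infinitesimal≈0 : infinitesimal ≈ 0ℝ
  infinitesimal≈0 = mk≈ λ ε 0<ε → eventually-map
    (λ n le → subst (ℚ._≤ ε) (sym (trans (cong ∣_∣ (ℚ.+-identityʳ (unit n))) (ℚ.0≤p⇒∣p∣≡p (ℚ.<⇒≤ (unit>0 n))))) le)
    (unit-small ε 0<ε)

  pointwise-≤ : ∀ {x y} → (∀ n → seq x n ℚ.≤ seq y n) → x ≤ y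
  pointwise-≤ {x} {y} le = mk≤ λ ε 0<ε → 0 , λ n _ → ℚ.≤-trans (le n)
    (ℚ.≤-trans (ℚ.≤-reflexive (sym (ℚ.+-identityʳ (seq y n)))) (ℚ.+-monoʳ-≤ (seq y n) (ℚ.<⇒≤ 0<ε)))

module SquareRoot (D : ℕ) (1≤D : 1 ℕ.≤ D) where

  -- The n-th approximation is the largest multiple of 1/(n+1) whose square is at most `D`.
  radicand numerator : ℕ → ℕ
  radicand n = D ℕ.* (suc n ℕ.* suc n)
  numerator n = proj₁ (isqrt (radicand n))

  approximation : ℕ → ℚ
  approximation n = fromℕ (numerator n) ℚ.* unit n

  abstract

    squared : ∀ a n → (fromℕ a ℚ.* unit n) ℚ.* (fromℕ a ℚ.* unit n) ≡ fromℕ (a ℕ.* a) ℚ.* (unit n ℚ.* unit n)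
    squared a n = trans (solve 2 (λ a u → (a :* u) :* (a :* u) := (a :* a) :* (u :* u)) refl (fromℕ a) (unit n))
      (cong (ℚ._* (unit n ℚ.* unit n)) (sym (fromℕ-homo-* a a)))

    radicand*unit² : ∀ n → fromℕ (radicand n) ℚ.* (unit n ℚ.* unit n) ≡ fromℕ D
    radicand*unit² n = begin
      fromℕ (radicand n) ℚ.* (u ℚ.* u)   ≡⟨ cong (ℚ._* (u ℚ.* u)) (trans (fromℕ-homo-* D (suc n ℕ.* suc n))
                                              (cong (fromℕ D ℚ.*_) (fromℕ-homo-* (suc n) (suc n)))) ⟩
      fromℕ D ℚ.* (N ℚ.* N) ℚ.* (u ℚ.* u)
        ≡⟨ solve 3 (λ D N u → D :* (N :* N) :* (u :* u) := D :* ((N :* u) :* (N :* u))) refl (fromℕ D) N u ⟩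
      fromℕ D ℚ.* ((N ℚ.* u) ℚ.* (N ℚ.* u))  ≡⟨ cong (λ z → fromℕ D ℚ.* (z ℚ.* z)) (fromℕ*unit n) ⟩
      fromℕ D ℚ.* (1ℚ ℚ.* 1ℚ)            ≡⟨ ℚ.*-identityʳ (fromℕ D) ⟩
      fromℕ D                            ∎
      where
      open ≡-Reasoning
      u N : ℚ
      u = unit n
      N = fromℕ (suc n)

    unit²>0 : ∀ n → 0ℚ ℚ.< unit n ℚ.* unit n
    unit²>0 n = pos* (unit n) (unit n) (unit>0 n) (unit>0 n)

    approximation²≤ : ∀ n → approximation n ℚ.* approximation n ℚ.≤ fromℕ D
    approximation²≤ n = subst₂ ℚ._≤_ (sym (squared (numerator n) n)) (radicand*unit² n)
      (ℚ.*-monoʳ-≤-nonNeg (unit n ℚ.* unit n) {{ℚ.nonNegative (ℚ.<⇒≤ (unit²>0 n))}}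
        (fromℕ-mono-≤ (numerator n ℕ.* numerator n) (radicand n) (proj₁ (proj₂ (isqrt (radicand n))))))

    approximation+unit : ∀ n → fromℕ (suc (numerator n)) ℚ.* unit n ≡ approximation n ℚ.+ unit n
    approximation+unit n = begin
      fromℕ (suc a) ℚ.* u             ≡⟨ cong (ℚ._* u) (trans (cong fromℕ (ℕ.+-comm 1 a)) (/1-homo-+ (+ a) (+ 1))) ⟩
      (fromℕ a ℚ.+ 1ℚ) ℚ.* u          ≡⟨ ℚ.*-distribʳ-+ u (fromℕ a) 1ℚ ⟩
      fromℕ a ℚ.* u ℚ.+ 1ℚ ℚ.* u      ≡⟨ cong (fromℕ a ℚ.* u ℚ.+_) (ℚ.*-identityˡ u) ⟩
      fromℕ a ℚ.* u ℚ.+ u             ∎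
      where
      open ≡-Reasoning
      u : ℚ
      u = unit n
      a : ℕ
      a = numerator n

    <approximation+unit² : ∀ n →
      fromℕ D ℚ.< (approximation n ℚ.+ unit n) ℚ.* (approximation n ℚ.+ unit n)
    <approximation+unit² n = subst₂ ℚ._<_ (radicand*unit² n)
      (trans (sym (squared (suc (numerator n)) n)) (cong (λ z → z ℚ.* z) (approximation+unit n)))
      (ℚ.*-monoˡ-<-pos (unit n ℚ.* unit n) {{ℚ.positive (unit²>0 n)}}
        (fromℕ-mono-< (radicand n) (suc (numerator n) ℕ.* suc (numerator n)) (proj₂ (proj₂ (isqrt (radicand n))))))

    -- As `D ≥ 1`, the radicand is at least `(n+1)²`. The uniform bound makes `w₊ - w₋`, which is
    -- twice the root, apart from 0 with an explicit gap.
    1≤approximation : ∀ n → 1ℚ ℚ.≤ approximation n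
    1≤approximation n = subst (ℚ._≤ approximation n) (fromℕ*unit n)
      (ℚ.*-monoʳ-≤-nonNeg (unit n) {{ℚ.nonNegative (ℚ.<⇒≤ (unit>0 n))}} (fromℕ-mono-≤ (suc n) a N≤a))
      where
      a : ℕ
      a = numerator n
      N≤a : suc n ℕ.≤ a
      N≤a = ℕ.≮⇒≥ λ a<N → ℕ.<-irrefl refl (begin-strict
        radicand n               <⟨ proj₂ (proj₂ (isqrt (radicand n))) ⟩
        suc a ℕ.* suc a          ≤⟨ ℕ.*-mono-≤ a<N a<N ⟩
        suc n ℕ.* suc n          ≤⟨ ℕ.m≤n*m (suc n ℕ.* suc n) D {{ℕ.>-nonZero 1≤D}} ⟩
        radicand n               ∎)
        where open ℕ.≤-Reasoning

    0≤approximation : ∀ n → 0ℚ ℚ.≤ approximation n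
    0≤approximation n = ℚ.≤-trans (ℚ.<⇒≤ (ℚ.positive⁻¹ 1ℚ)) (1≤approximation n)

    -- The squares of the two sides lie on either side of `D`. With `m` and `n` exchanged it also
    -- bounds the difference from the other side.
    approximation-bound : ∀ m n → approximation m ℚ.≤ approximation n ℚ.+ unit n
    approximation-bound m n = p²<q²⇒p≤q (approximation m) (approximation n ℚ.+ unit n)
      (ℚ.+-mono-≤ (0≤approximation n) (ℚ.<⇒≤ (unit>0 n)))
      (ℚ.≤-<-trans (approximation²≤ m) (<approximation+unit² n))

  √ : ℝ
  √ .seq    = approximation
  √ .cauchy = cauchy-from-bound approximation approximation-bound

  √-isSqrt : √ IsSqrtOf fromℤ (+ D)
  √-isSqrt = pointwise-≤ 0≤approximation , ≤-antisym (pointwise-≤ approximation²≤)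
    (≤-trans (pointwise-≤ {y = (√ + infinitesimal) * (√ + infinitesimal)} λ n → ℚ.<⇒≤ (<approximation+unit² n))
      (≈⇒≤ (*-cong √+≈√ √+≈√)))
    where
    √+≈√ : √ + infinitesimal ≈ √
    √+≈√ = ≈-trans (+-cong ≈-refl infinitesimal≈0) (+-identityʳ √)

-- Closed form

w₊-w₋>0 : ∀ k r → (∀ n → 1ℚ ℚ.≤ seq r n) → w₊ k r - w₋ k r # 0ℝ
w₊-w₋>0 k r 1≤r = inj₂ (mk< 1ℚ (ℚ.positive⁻¹ 1ℚ) (0 , λ n _ → subst (1ℚ ℚ.≤_)
  (solve 2 (λ k r → r :+ r := (k :+ r) :- (k :- r)) refl (+ k ℚ./ 1) (seq r n))
  (ℚ.+-mono-≤ (ℚ.≤-trans (ℚ.<⇒≤ (ℚ.positive⁻¹ 1ℚ)) (1≤r n)) (1≤r n))))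

module ClosedForm (k : ℕ) (c : ℤ) (r : ℝ) (r#0 : w₊ k r - w₋ k r # 0ℝ)
  (r² : r * r ≈ fromℤ ((+ k) ℤ.^ 2 ℤ.- + 4 ℤ.* c)) where

  κ γ A : ℝ
  κ = fromℤ (+ k)
  γ = fromℤ c
  A = fromℤ (+ 2 ℤ.* + k) ÷ (w₊ k r - w₋ k r) [ r#0 ]

  discriminant≡ : ((+ k) ℤ.^ 2 ℤ.- + 4 ℤ.* c) ℚ./ 1 ≡
    (+ k ℚ./ 1) ℚ.* (+ k ℚ./ 1) ℚ.- (+ 4 ℚ./ 1) ℚ.* (c ℚ./ 1)
  discriminant≡ = begin
    ((+ k) ℤ.^ 2 ℤ.- + 4 ℤ.* c) ℚ./ 1
      ≡⟨ cong (ℚ._/ 1) (Z.solve 2 (λ k c → k Z.:* (k Z.:* Z.con (+ 1)) Z.:- Z.con (+ 4) Z.:* c Z.:=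
           k Z.:* k Z.:+ Z.con (ℤ.- + 4) Z.:* c) refl (+ k) c) ⟩
    (+ k ℤ.* + k ℤ.+ (ℤ.- + 4) ℤ.* c) ℚ./ 1
      ≡⟨ trans (/1-homo-+ (+ k ℤ.* + k) ((ℤ.- + 4) ℤ.* c)) (cong₂ ℚ._+_ (/1-homo-* (+ k) (+ k)) (/1-homo-* (ℤ.- + 4) c)) ⟩
    q ℚ.* q ℚ.+ (ℚ.- (+ 4 ℚ./ 1)) ℚ.* (c ℚ./ 1)
      ≡⟨ solve 3 (λ q f c → q :* q :+ (:- f) :* c := q :* q :- f :* c) refl q (+ 4 ℚ./ 1) (c ℚ./ 1) ⟩
    q ℚ.* q ℚ.- (+ 4 ℚ./ 1) ℚ.* (c ℚ./ 1) ∎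
    where
    open ≡-Reasoning
    module Z = ℤ-Solver.+-*-Solver
    q = + k ℚ./ 1

  four : ℝ
  four = fromℚ (+ 4 ℚ./ 1)

  r²≈ : r * r ≈ κ * κ - four * γ
  r²≈ = ≈-trans r² (≗⇒≈ λ _ → discriminant≡)

  -- w₊ and w₋ are twice the roots of x² - k x + c.
  root : ∀ ρ → ρ * ρ ≈ r * r → (κ + ρ) * (κ + ρ) ≈ (κ + κ) * (κ + ρ) - four * γ
  root ρ ρ² = begin
    (κ + ρ) * (κ + ρ)
      ≈⟨ ≗⇒≈ (λ n → solve 2 (λ k x → (k :+ x) :* (k :+ x) := k :* k :+ (k :+ k) :* x :+ x :* x) refl
           (seq κ n) (seq ρ n)) ⟩
    κ * κ + (κ + κ) * ρ + ρ * ρ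
      ≈⟨ +-cong ≈-refl (≈-trans ρ² r²≈) ⟩
    κ * κ + (κ + κ) * ρ + (κ * κ - four * γ)
      ≈⟨ ≗⇒≈ (λ n → solve 3 (λ k x c → k :* k :+ (k :+ k) :* x :+ (k :* k :- c) := (k :+ k) :* (k :+ x) :- c) refl
           (seq κ n) (seq ρ n) (seq (four * γ) n)) ⟩
    (κ + κ) * (κ + ρ) - four * γ ∎
    where open ≈-Reasoning

  -- The closed form with exponent `suc n`, so that powers unfold in the recurrence. It has the
  -- value 1 at n = 0, where the induction starts.
  form : ℕ → ℝ
  form n = fromℚ ½ ^ suc n * (w₋ k r ^ n + w₊ k r ^ n + A * (w₊ k r ^ n - w₋ k r ^ n))

  form-0 : form 0 ≈ 1ℝ
  form-0 = ≗⇒≈ λ n → solve 1 (λ A → (con ½ :* con 1ℚ) :* ((con 1ℚ :+ con 1ℚ) :+ A :* (con 1ℚ :- con 1ℚ)) := con 1ℚ)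
    refl (seq A n)

  -- The coefficient `A` is made for this value: `A * (w₊ - w₋)` is `2k`, as is `w₋ + w₊`, and a
  -- quarter of the total `4k` is `k`.
  form-1 : form 1 ≈ κ
  form-1 = begin
    form 1
      ≈⟨ ≗⇒≈ (λ n → solve 3 (λ A a b → (con ½ :* (con ½ :* con 1ℚ)) :*
               ((a :* con 1ℚ :+ b :* con 1ℚ) :+ A :* (b :* con 1ℚ :- a :* con 1ℚ))
               := con ½ :* con ½ :* (a :+ b :+ A :* (b :- a))) refl
           (seq A n) (seq (w₋ k r) n) (seq (w₊ k r) n)) ⟩
    fromℚ ½ * fromℚ ½ * (w₋ k r + w₊ k r + A * (w₊ k r - w₋ k r))
      ≈⟨ *-cong ≈-refl (+-cong ≈-refl A*) ⟩
    fromℚ ½ * fromℚ ½ * (w₋ k r + w₊ k r + fromℚ (+ 2 ℚ./ 1) * κ)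
      ≈⟨ ≗⇒≈ (λ n → solve 2 (λ k r → con ½ :* con ½ :* ((k :- r) :+ (k :+ r) :+ con (+ 2 ℚ./ 1) :* k) := k) refl
           (seq κ n) (seq r n)) ⟩
    κ ∎
    where
    open ≈-Reasoning
    w = w₊ k r - w₋ k r
    A* : A * w ≈ fromℚ (+ 2 ℚ./ 1) * κ
    A* = begin
      A * w
        ≈⟨ ≗⇒≈ (λ n → solve 3 (λ t i w → (t :* i) :* w := t :* (w :* i)) refl
             (seq (fromℤ (+ 2 ℤ.* + k)) n) (seq (inv w r#0) n) (seq w n)) ⟩
      fromℤ (+ 2 ℤ.* + k) * (w * inv w r#0)  ≈⟨ *-cong ≈-refl (inv-inverseʳ w r#0) ⟩
      fromℤ (+ 2 ℤ.* + k) * 1ℝ               ≈⟨ *-identityʳ _ ⟩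
      fromℤ (+ 2 ℤ.* + k)                    ≈⟨ ≗⇒≈ (λ _ → /1-homo-* (+ 2) (+ k)) ⟩
      fromℚ (+ 2 ℚ./ 1) * κ                  ∎

  -- Both roots satisfy `w² = 2k w - 4c`; the additional powers of ½ cancel the 2 and the 4, leaving
  -- the coefficients `k` and `c`.
  form-recurrence : ∀ n → form (2 ℕ.+ n) ≈ κ * form (suc n) - γ * form n
  form-recurrence n = begin
    fromℚ ½ * (fromℚ ½ * H) * (a * (a * p) + b * (b * q) + A * (b * (b * q) - a * (a * p)))
      ≈⟨ *-cong ≈-refl (+-cong (+-cong a² b²) (*-cong ≈-refl (+-cong b² (neg-cong a²)))) ⟩
    fromℚ ½ * (fromℚ ½ * H) * (a′ * p + b′ * q + A * (b′ * q - a′ * p))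
      ≈⟨ ≗⇒≈ (λ i → solve 8 (λ κ γ A H a b p q →
           let a′ = (κ :+ κ) :* a :- con (+ 4 ℚ./ 1) :* γ
               b′ = (κ :+ κ) :* b :- con (+ 4 ℚ./ 1) :* γ
           in con ½ :* (con ½ :* H) :* (a′ :* p :+ b′ :* q :+ A :* (b′ :* q :- a′ :* p))
              := κ :* (con ½ :* H :* (a :* p :+ b :* q :+ A :* (b :* q :- a :* p)))
                 :- γ :* (H :* (p :+ q :+ A :* (q :- p)))) refl
           (seq κ i) (seq γ i) (seq A i) (seq H i) (seq a i) (seq b i) (seq p i) (seq q i)) ⟩
    κ * form (suc n) - γ * form n ∎
    where
    open ≈-Reasoning
    H = fromℚ ½ ^ suc n
    a = w₋ k r
    b = w₊ k r
    p = a ^ n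
    q = b ^ n
    a′ = (κ + κ) * a - four * γ
    b′ = (κ + κ) * b - four * γ
    a² : a * (a * p) ≈ a′ * p
    a² = ≈-trans (≈-sym (*-assoc a a p)) (*-cong (root (- r)
      (≗⇒≈ λ n → solve 1 (λ r → (:- r) :* (:- r) := r :* r) refl (seq r n))) ≈-refl)
    b² : b * (b * q) ≈ b′ * q
    b² = ≈-trans (≈-sym (*-assoc b b q)) (*-cong (root r ≈-refl) ≈-refl)

  closed-form : (b : ℕ → ℕ) → b 0 ≡ 1 → b 1 ≡ k →
    (∀ n → + b (2 ℕ.+ n) ≡ + k ℤ.* + b (suc n) ℤ.- c ℤ.* + b n) →
    ∀ n → fromℤ (+ b n) ≈ closedForm k r r#0 n
  closed-form b b0 b1 rec n = ≈-trans (proj₁ (consecutive n))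
    (*-cong (≈-reflexive (cong (fromℚ ½ ^_) (ℕ.+-comm 1 n))) ≈-refl)
    where
    consecutive : ∀ n → fromℤ (+ b n) ≈ form n × fromℤ (+ b (suc n)) ≈ form (suc n)
    consecutive zero = ≈-trans (≗⇒≈ λ _ → cong fromℕ b0) (≈-sym form-0) ,
                       ≈-trans (≗⇒≈ λ _ → cong fromℕ b1) (≈-sym form-1)
    consecutive (suc n) = let bₙ , bₙ₊₁ = consecutive n in bₙ₊₁ , (begin
      fromℤ (+ b (2 ℕ.+ n))
        ≈⟨ ≗⇒≈ (λ _ → trans (cong (ℚ._/ 1) (trans (rec n) (negate (+ k ℤ.* + b (suc n)) (+ b n))))
             (trans (/1-homo-+ (+ k ℤ.* + b (suc n)) (c ℤ.* (ℤ.- + 1 ℤ.* + b n)))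
               (cong₂ ℚ._+_ (/1-homo-* (+ k) (+ b (suc n)))
                 (trans (/1-homo-* c (ℤ.- + 1 ℤ.* + b n)) (trans (cong ((c ℚ./ 1) ℚ.*_) (/1-homo-* (ℤ.- + 1) (+ b n)))
                   (solve 2 (λ c b → c :* (con (ℤ.- + 1 ℚ./ 1) :* b) := :- (c :* b)) refl (c ℚ./ 1) (fromℕ (b n)))))))) ⟩
      κ * fromℤ (+ b (suc n)) - γ * fromℤ (+ b n)
        ≈⟨ +-cong (*-cong ≈-refl bₙ₊₁) (neg-cong (*-cong ≈-refl bₙ)) ⟩
      κ * form (suc n) - γ * form n
        ≈⟨ form-recurrence n ⟨
      form (2 ℕ.+ n) ∎)
      where
      open ≈-Reasoning
      module Z = ℤ-Solver.+-*-Solver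
      -- The passage from ℤ to ℚ is established for `+` and `*`, so the subtraction is written with
      -- a factor -1.
      negate : ∀ x y → x ℤ.- c ℤ.* y ≡ x ℤ.+ c ℤ.* (ℤ.- + 1 ℤ.* y)
      negate x y = Z.solve 3 (λ x c y → x Z.:- c Z.:* y Z.:= x Z.:+ c Z.:* (Z.con (ℤ.- + 1) Z.:* y)) refl x c y

abstract

  binet : ∀ k c D → 1 ℕ.≤ D → + D ≡ (+ k) ℤ.^ 2 ℤ.- + 4 ℤ.* c →
    (b : ℕ → ℕ) → b 0 ≡ 1 → b 1 ≡ k → (∀ n → + b (2 ℕ.+ n) ≡ + k ℤ.* + b (suc n) ℤ.- c ℤ.* + b n) →
    Σ[ √D ∈ ℝ ] (√D IsSqrtOf fromℤ ((+ k) ℤ.^ 2 ℤ.- + 4 ℤ.* c)) ×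
      Σ[ w₊-w₋#0 ∈ w₊ k √D - w₋ k √D # 0ℝ ] (∀ n → fromℤ (+ b n) ≈ closedForm k √D w₊-w₋#0 n)
  binet k c D 1≤D D≡ b b0 b1 rec =
    √ , isSqrt , w#0 , ClosedForm.closed-form k c √ w#0 (proj₂ isSqrt) b b0 b1 rec
    where
    open SquareRoot D 1≤D
    isSqrt : √ IsSqrtOf fromℤ ((+ k) ℤ.^ 2 ℤ.- + 4 ℤ.* c)
    isSqrt = subst (λ z → √ IsSqrtOf fromℤ z) D≡ √-isSqrt
    w#0 : w₊ k √ - w₋ k √ # 0ℝ
    w#0 = w₊-w₋>0 k √ 1≤approximation

theorem4p2 : (k s : ℕ) → 1 ℕ.≤ k → 1 ℕ.≤ s → ⌈ k /2⌉ ℕ.≤ s → s ℕ.≤ k →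
    Σ[ b ∈ (ℕ → ℕ) ]
    (∀ n → 1 ℕ.≤ n → HasVertexCount (polytope n k s) (b n)) ×
    ((1+Σ b) IsInverseOf denominator k s) ×
    (∀ n → 2 ℕ.≤ n → + b (n ℕ.+ 2) ℤ.- + k ℤ.* + b (n ℕ.+ 1) ℤ.+ coeff₂ k s ℤ.* + b n ≡ + 0) ×
    (b 1 ≡ k) ×
    (+ b 2 ≡ (+ k) ℤ.^ 2 ℤ.- coeff₂ k s) ×
    (Σ[ √D ∈ ℝ ] (√D IsSqrtOf discriminant k s) ×
    (Σ[ w₊-w₋#0 ∈ (w₊ k √D - w₋ k √D # 0ℝ) ]
    (∀ n → 1 ℕ.≤ n → fromℤ (+ b n) ≈ closedForm k √D w₊-w₋#0 n)))
theorem4p2 k s 1≤k _ ⌈k/2⌉≤s s≤k with ℕ.m≤n⇒∃[o]m+o≡n s≤k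
... | m , refl =
  count ,
  (λ { (suc l) _ → Vertices.hasVertexCount s m m≤s l }) ,
  generating-function k s count refl count-1 recurrence ,
  (λ n _ → shifted-recurrence s m m≤s n) ,
  count-1 ,
  count-2 s m m≤s ,
  (let D , 1≤D , D≡ = positive-discriminant s m m≤s 1≤k
       √D , isSqrt , w#0 , closed = binet k (coeff₂ k s) D 1≤D D≡ count refl count-1 recurrence
   in √D , isSqrt , w#0 , λ n _ → closed n)
  where
  m≤s : m ℕ.≤ s
  m≤s = ⌈s+m/2⌉≤s⇒m≤s s m ⌈k/2⌉≤s

  open Offsets s m m≤s using (count; count-1)
  recurrence = count-recurrence-ℤ s m m≤s
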